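{- Let $p>3$ be a prime and let $x=r/m$, where $0<r<m$ are integers with $m$ prime to $p$. Then $$\sum_{k=1}^{p-1}\frac{(x)_k(1-x)_k}{(1)_k^2}\cdot\frac{1}{k}\equiv Q_p(x)+\frac{1}{2}p\,Q_p(x)^2\pmod{p^2},$$ and $$\sum_{k=1}^{p-1}\frac{(x)_k(1-x)_k}{(1)_k^2}\cdot\frac{1}{k^2}\equiv -\frac{1}{2}Q_p(x)^2\pmod{p}.$$
   Context: $(y)_n=y(y+1)\cdots(y+n-1)$ is the Pochhammer symbol, with $(y)_0=1$. For $m$ prime to $p$, $[c]_m$ denotes the unique representative of the rational $c$ (denominator prime to $m$) modulo $m$ in $\{0,1,\dots,m-1\}$; thus $[r/p]_m$ is the residue of $r p^{ -1}$ mod $m$. The Pochhammer quotient is $$Q_p(x)=\frac{1}{p}\left(1-\frac{(x)_p(1-x)_p}{(1)_p^2}\cdot\frac{m^2}{[r/p]_m[-r/p]_m}\right),$$ which is a $p$-integral rational. For rationals $u,v$, $u\equiv v\pmod{p^s}$ means $u-v$ has $p$-adic valuation at least $s$. -}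

module Defs where

open import Data.Nat as ℕ using (ℕ; zero; suc; _^_)
open import Data.Nat.Divisibility using (_∣?_)
import Data.Nat.Divisibility as ℕD
open import Data.Integer as ℤ using (ℤ; +_; ∣_∣)
open import Data.Rational using (ℚ; 0ℚ; 1ℚ; _+_; _*_; _-_; -_; _÷_; ↥_; ↧ₙ_; ≢-nonZero)
open import Data.Rational.Properties using (_≟_)
open import Data.Bool using (Bool; true; false; if_then_else_)
open import Data.Product using (_×_)
open import Relation.Nullary using (¬_; yes; no)
open import Relation.Nullary.Decidable using (does)

ℕ→ℚ : ℕ → ℚ
ℕ→ℚ n = Data.Rational._/_ (+ n) 1

-- total division on ℚ (u ⊘ 0 = 0); only ever used with nonzero divisors here
_⊘_ : ℚ → ℚ → ℚ
u ⊘ v with v ≟ 0ℚ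
... | yes _ = 0ℚ
... | no v≢0 = _÷_ u v {{≢-nonZero v≢0}}

infixl 7 _⊘_

poch : ℚ → ℕ → ℚ
poch y zero = 1ℚ
poch y (suc n) = poch y n * (y + ℕ→ℚ n)

sum1to : ℕ → (ℕ → ℚ) → ℚ
sum1to zero f = 0ℚ
sum1to (suc n) f = sum1to n f + f (suc n)

firstFrom : (ℕ → Bool) → ℕ → ℕ → ℕ
firstFrom P t zero = 0
firstFrom P t (suc n) = if P t then t else firstFrom P (suc t) n

-- [c]_m : the representative t ∈ {0,…,m-1} of the rational c modulo m,
-- i.e. the t with m ∣ numerator (t - c)  (c has denominator prime to m)
resMod : ℕ → ℚ → ℕ
resMod m c = firstFrom (λ t → does (m ∣? ∣ ↥ (ℕ→ℚ t - c) ∣)) 0 m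

Qp : ℕ → ℕ → ℕ → ℚ
Qp p r m =
  (1ℚ ⊘ ℕ→ℚ p) *
  (1ℚ - (poch x p * poch (1ℚ - x) p) ⊘ (poch 1ℚ p * poch 1ℚ p)
        * ((ℕ→ℚ m * ℕ→ℚ m) ⊘ (ℕ→ℚ (resMod m (ℕ→ℚ r ⊘ ℕ→ℚ p))
                               * ℕ→ℚ (resMod m (- (ℕ→ℚ r ⊘ ℕ→ℚ p))))))
  where
  x : ℚ
  x = ℕ→ℚ r ⊘ ℕ→ℚ m

-- u ≡ v (mod p^s): the p-adic valuation of u - v is at least s,
-- i.e. (u - v = n/d in lowest terms) p^s ∣ n and p ∤ d
_≡_mod_^_ : ℚ → ℚ → ℕ → ℕ → Set
u ≡ v mod p ^ s = (p ℕ.^ s) ℕD.∣ ∣ ↥ (u - v) ∣ × ¬ (p ℕD.∣ ↧ₙ (u - v))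

infix 4 _≡_mod_^_

-- Let n = p - 1, let F(x) and S(x) be the two sums over 1 ≤ k ≤ n, and let
-- G(x) = ∏ (1 - x²/k²).  The shift x ↦ x + 1 telescopes exactly:
--   x (F(x+1) - F(x)) = 2 (G(x) - 1),
--   x² (S(x+1) - S(x)) = 2 (x F(x) - (1 - G(x))).
-- Put s = [r/p]ₘ and choose 0 ≤ a < p with s p = r + a m.  Then
-- [-r/p]ₘ = m - s, and x = p y - a with y = s/m.  Moving from p y down to x
-- passes only through the points z = p y - j with 0 < j < p, which are p-adic
-- units at which G(z) ≡ 0 (mod p²).  At such z, with w = p/z,
--   p F(z) ≡ p F(z+1) + 2 w (mod p³),
-- while 1 - p Q, as a function of the point, is multiplied by
-- (1 - w)/(1 + w) exactly; and u + u²/2 ≡ -log (1 - u) (mod p³) for p ∣ u.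
-- So p F ≡ -log (1 - p Q) (mod p³) propagates from p y to x, as does
-- S ≡ -F²/2 (mod p).  At p y they hold because F ≡ p y ∑ 1/k² and
-- ∑ 1/k² ≡ 0 (mod p).
module Submission where

open import Defs
open import Data.Bool using (true; false; if_then_else_)
open import Data.Integer as ℤ using (ℤ; +_; ∣_∣)
import Data.Integer.Divisibility.Signed as ℤD
import Data.Integer.Properties as ℤₚ
import Data.Integer.Solver
open import Data.Nat as ℕ using (ℕ; zero; suc; _<_; _≤_; _∸_; s≤s; z<s; s<s)
import Data.Nat.Coprimality as C
open C using (Coprime)
import Data.Nat.Divisibility as ℕD
open import Data.Nat.DivMod using (_/_; _%_; m%n<n; m≡m%n+[m/n]*n)
open import Data.Nat.GCD using (module Bézout)
open import Data.Nat.Primality using (Prime; euclidsLemma; prime⇒nonZero; prime⇒nonTrivial; prime⇒irreducible)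
import Data.Nat.Properties as ℕₚ
import Data.Nat.Solver
open import Data.Product using (_×_; _,_; ∃-syntax; proj₁; proj₂)
open import Data.Rational using (ℚ; mkℚ; 1ℚ; 0ℚ; ½; _+_; _*_; _-_; -_; 1/_; ↥_; ↧_; ↧ₙ_; toℚᵘ; ≢-nonZero)
import Data.Rational.Properties as ℚₚ
open import Data.Rational.Solver
open +-*-Solver using (solve; con; _:+_; _:*_; _:-_; :-_; _:=_)
import Data.Rational.Unnormalised as ℚᵘ
import Data.Rational.Unnormalised.Properties as ℚᵘₚ
open import Data.Sum using (inj₁; inj₂; [_,_]′)
open import Function using (_∘_; _$_)
open import Relation.Binary.PropositionalEquality using (_≡_; _≢_; refl; sym; trans; cong; cong₂; subst; module ≡-Reasoning)
open import Relation.Nullary using (¬_; yes; no; contradiction)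
open import Relation.Nullary.Decidable using (does; dec-true; dec-false)

private module ℤSolver = Data.Integer.Solver.+-*-Solver
private module ℕSolver = Data.Nat.Solver.+-*-Solver

open ≡-Reasoning

-- The shift identities yield the sums at z from those at z + 1 only after division by z or z², so
-- meeting a p-adic multiple of p on the way would destroy precision. Hence the walk starts at such
-- a multiple and ends before the next one. The constant m² / ([r/p]ₘ [-r/p]ₘ) equals 1 / (y (1 -
-- y)) and stays fixed along the walk. Its origin is visible at x = p y: there (x)ₚ (1 - x)ₚ / p!²
-- is G(x) times x (p - x) / p² = y (1 - y). The constant removes the last factor, so 1 - p Q starts
-- out as G(p y), which is very close to 1. The logarithm appears because 1 - p Q changes by a
-- factor at each step while p F changes by a summand. The assumption p > 3 enters through ∑ 1/k² ≡
-- 0, where 3 has to be inverted.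

2ℚ : ℚ
2ℚ = 1ℚ + 1ℚ

-- Integers and fractions inside the rationals

ι : ℤ → ℚ
ι a = a Data.Rational./ 1

toℚᵘ-ι : ∀ a → toℚᵘ (ι a) ℚᵘ.≃ ℚᵘ.mkℚᵘ a 0
toℚᵘ-ι a = ℚₚ.toℚᵘ-fromℚᵘ (ℚᵘ.mkℚᵘ a 0)

ι-homo-+ : ∀ a b → ι (a ℤ.+ b) ≡ ι a + ι b
ι-homo-+ a b = ℚₚ.toℚᵘ-injective $ ℚᵘₚ.≃-trans (toℚᵘ-ι (a ℤ.+ b)) $ ℚᵘₚ.≃-sym $
  ℚᵘₚ.≃-trans (ℚₚ.toℚᵘ-homo-+ (ι a) (ι b)) $
  ℚᵘₚ.≃-trans (ℚᵘₚ.+-cong (toℚᵘ-ι a) (toℚᵘ-ι b)) $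
  ℚᵘ.*≡* (cong (ℤ._* ℤ.1ℤ) (cong₂ ℤ._+_ (ℤₚ.*-identityʳ a) (ℤₚ.*-identityʳ b)))

ι-homo-* : ∀ a b → ι (a ℤ.* b) ≡ ι a * ι b
ι-homo-* a b = ℚₚ.toℚᵘ-injective $ ℚᵘₚ.≃-trans (toℚᵘ-ι (a ℤ.* b)) $ ℚᵘₚ.≃-sym $
  ℚᵘₚ.≃-trans (ℚₚ.toℚᵘ-homo-* (ι a) (ι b)) $
  ℚᵘₚ.≃-trans (ℚᵘₚ.*-cong (toℚᵘ-ι a) (toℚᵘ-ι b)) $
  ℚᵘ.*≡* refl

ι-homo-neg : ∀ a → ι (ℤ.- a) ≡ - ι a
ι-homo-neg a = ℚₚ.toℚᵘ-injective $ ℚᵘₚ.≃-trans (toℚᵘ-ι (ℤ.- a)) $ ℚᵘₚ.≃-sym $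
  ℚᵘₚ.≃-trans (ℚₚ.toℚᵘ-homo‿- (ι a)) (ℚᵘₚ.-‿cong (toℚᵘ-ι a))

ι-injective : ∀ {a b} → ι a ≡ ι b → a ≡ b
ι-injective {a} {b} eq
  with ℚᵘₚ.≃-trans (ℚᵘₚ.≃-sym (toℚᵘ-ι a)) (ℚᵘₚ.≃-trans (ℚₚ.toℚᵘ-cong eq) (toℚᵘ-ι b))
... | ℚᵘ.*≡* a≡b = trans (sym (ℤₚ.*-identityʳ a)) (trans a≡b (ℤₚ.*-identityʳ b))

*-denominator : ∀ q → q * ι (↧ q) ≡ ι (↥ q)
*-denominator q@record{} = ℚₚ.toℚᵘ-injective $
  ℚᵘₚ.≃-trans (ℚₚ.toℚᵘ-homo-* q (ι (↧ q))) $
  ℚᵘₚ.≃-trans (ℚᵘₚ.*-congˡ {toℚᵘ q} (toℚᵘ-ι (↧ q))) $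
  ℚᵘₚ.≃-trans (ℚᵘ.*≡* (ℤₚ.*-assoc (↥ q) (↧ q) (ℤ.1ℤ))) (ℚᵘₚ.≃-sym (toℚᵘ-ι (↥ q)))

ℕ→ℚ-homo-+ : ∀ m n → ℕ→ℚ (m ℕ.+ n) ≡ ℕ→ℚ m + ℕ→ℚ n
ℕ→ℚ-homo-+ m n = ι-homo-+ (+ m) (+ n)

ℕ→ℚ-homo-* : ∀ m n → ℕ→ℚ (m ℕ.* n) ≡ ℕ→ℚ m * ℕ→ℚ n
ℕ→ℚ-homo-* m n = trans (cong ι (ℤₚ.pos-* m n)) (ι-homo-* (+ m) (+ n))

ℕ→ℚ-suc : ∀ n → ℕ→ℚ (suc n) ≡ 1ℚ + ℕ→ℚ n
ℕ→ℚ-suc = ℕ→ℚ-homo-+ 1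

-- Reciprocals, factorials and Pochhammer symbols

*-inverse-⊘ : ∀ {u} → u ≢ 0ℚ → u * (1ℚ ⊘ u) ≡ 1ℚ
*-inverse-⊘ {u} u≢0 with u ℚₚ.≟ 0ℚ
... | yes u≡0 = contradiction u≡0 u≢0
... | no u≢0′ = trans (cong (u *_) (ℚₚ.*-identityˡ (1/_ u {{≢-nonZero u≢0′}}))) (ℚₚ.*-inverseʳ u {{≢-nonZero u≢0′}})

-- This eliminates total division: once some inverse of the divisor is exhibited, a quotient is a
-- product and the ring solver applies. All later work is done with `recip` and `recip!`.
⊘≡* : ∀ u v w → v * w ≡ 1ℚ → u ⊘ v ≡ u * w
⊘≡* u v w vw≡1 with v ℚₚ.≟ 0ℚ
... | yes refl = contradiction (trans (sym (ℚₚ.*-zeroˡ w)) vw≡1) λ ()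
... | no v≢0 = cong (u *_) (begin
  v⁻¹                 ≡⟨ ℚₚ.*-identityʳ v⁻¹ ⟨
  v⁻¹ * 1ℚ            ≡⟨ cong (v⁻¹ *_) vw≡1 ⟨
  v⁻¹ * (v * w)       ≡⟨ ℚₚ.*-assoc v⁻¹ v w ⟨
  (v⁻¹ * v) * w       ≡⟨ cong (_* w) (ℚₚ.*-inverseˡ v {{≢-nonZero v≢0}}) ⟩
  1ℚ * w              ≡⟨ ℚₚ.*-identityˡ w ⟩
  w                   ∎)
  where v⁻¹ = 1/_ v {{≢-nonZero v≢0}}

ι-nonZero : ∀ {a} → a ≢ ℤ.0ℤ → ι a ≢ 0ℚ
ι-nonZero a≢0 ιa≡0 = a≢0 (ι-injective ιa≡0)

recip : ℕ → ℚ
recip n = 1ℚ ⊘ ℕ→ℚ n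

*-recip : ∀ n → .{{ℕ.NonZero n}} → ℕ→ℚ n * recip n ≡ 1ℚ
*-recip (suc n) = *-inverse-⊘ (ι-nonZero {+ suc n} λ ())

recip! : ℕ → ℚ
recip! zero = 1ℚ
recip! (suc n) = recip! n * recip (suc n)

poch-1 : ∀ n → poch 1ℚ n * recip! n ≡ 1ℚ
poch-1 zero = refl
poch-1 (suc n) = begin
  poch 1ℚ n * (1ℚ + ℕ→ℚ n) * (recip! n * recip (suc n))
    ≡⟨ cong (λ k → poch 1ℚ n * k * (recip! n * recip (suc n))) (ℕ→ℚ-suc n) ⟨
  poch 1ℚ n * ℕ→ℚ (suc n) * (recip! n * recip (suc n))
    ≡⟨ solve 4 (λ a b c d → a :* b :* (c :* d) := (a :* c) :* (b :* d)) refl (poch 1ℚ n) (ℕ→ℚ (suc n)) (recip! n) (recip (suc n)) ⟩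
  (poch 1ℚ n * recip! n) * (ℕ→ℚ (suc n) * recip (suc n))
    ≡⟨ cong₂ _*_ (poch-1 n) (*-recip (suc n)) ⟩
  1ℚ ∎

-- The definition splits off the last factor; shifting `y` by 1 needs the first one split off.
poch-suc : ∀ y n → poch y (suc n) ≡ y * poch (1ℚ + y) n
poch-suc y zero = solve 1 (λ y → con 1ℚ :* (y :+ con 0ℚ) := y :* con 1ℚ) refl y
poch-suc y (suc n) = begin
  poch y (suc n) * (y + ℕ→ℚ (suc n))
    ≡⟨ cong₂ (λ P k → P * (y + k)) (poch-suc y n) (ℕ→ℚ-suc n) ⟩
  y * poch (1ℚ + y) n * (y + (1ℚ + ℕ→ℚ n))
    ≡⟨ solve 3 (λ y P k → y :* P :* (y :+ (con 1ℚ :+ k)) := y :* (P :* (con 1ℚ :+ y :+ k))) refl y (poch (1ℚ + y) n) (ℕ→ℚ n) ⟩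
  y * (poch (1ℚ + y) n * (1ℚ + y + ℕ→ℚ n)) ∎

-- Residues of rationals and a linear congruence

numerator⊥denominator : ∀ q → Coprime ∣ ↥ q ∣ (↧ₙ q)
numerator⊥denominator (mkℚ _ _ c) = C.recompute c

-- The bound `k < n` keeps the search from running out of fuel, where it would return 0. The start
-- `t` is arbitrary because the recursion advances it.
firstFrom-least : ∀ P t n k → k < n → P (t ℕ.+ k) ≡ true → (∀ j → j < k → P (t ℕ.+ j) ≡ false) → firstFrom P t n ≡ t ℕ.+ k
firstFrom-least P t (suc n) zero _ Pt _ = begin
  (if P t then t else firstFrom P (suc t) n)
    ≡⟨ cong (λ b → if b then t else firstFrom P (suc t) n) (trans (cong P (sym (ℕₚ.+-identityʳ t))) Pt) ⟩
  t         ≡⟨ ℕₚ.+-identityʳ t ⟨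
  t ℕ.+ 0   ∎
firstFrom-least P t (suc n) (suc k) (s<s k<n) Pt+k ¬P = begin
  (if P t then t else firstFrom P (suc t) n)
    ≡⟨ cong (λ b → if b then t else firstFrom P (suc t) n) (trans (cong P (sym (ℕₚ.+-identityʳ t))) (¬P 0 z<s)) ⟩
  firstFrom P (suc t) n
    ≡⟨ firstFrom-least P (suc t) n k k<n (trans (cong P (sym (ℕₚ.+-suc t k))) Pt+k)
         (λ j j<k → trans (cong P (sym (ℕₚ.+-suc t j))) (¬P (suc j) (s<s j<k))) ⟩
  suc t ℕ.+ k   ≡⟨ ℕₚ.+-suc t k ⟨
  t ℕ.+ suc k   ∎

module _ {m q : ℕ} (m⊥q : Coprime m q) {c : ℚ} {e : ℤ} (c*q≡e : c * ℕ→ℚ q ≡ ι e) where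

  private
    -- The numerator of `t - c` over the possibly unreduced denominator `q`. `cross` compares it
    -- with the reduced numerator that `resMod` tests.
    residual : ℕ → ℤ
    residual t = + t ℤ.* + q ℤ.- e

    cross : ∀ t → let w = ℕ→ℚ t - c in ∣ ↥ w ∣ ℕ.* q ≡ ∣ residual t ∣ ℕ.* ↧ₙ w
    cross t = trans (sym (ℤₚ.abs-* (↥ w) (+ q))) (trans (cong ∣_∣ crossℤ) (ℤₚ.abs-* (residual t) (↧ w)))
      where
      w = ℕ→ℚ t - c
      w*q : w * ℕ→ℚ q ≡ ι (residual t)
      w*q = begin
        (ℕ→ℚ t - c) * ℕ→ℚ q             ≡⟨ solve 3 (λ t c q → (t :- c) :* q := t :* q :- c :* q) refl (ℕ→ℚ t) c (ℕ→ℚ q) ⟩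
        ℕ→ℚ t * ℕ→ℚ q - c * ℕ→ℚ q       ≡⟨ cong₂ _-_ (sym (ι-homo-* (+ t) (+ q))) c*q≡e ⟩
        ι (+ t ℤ.* + q) - ι e           ≡⟨ cong (λ d → ι (+ t ℤ.* + q) + d) (ι-homo-neg e) ⟨
        ι (+ t ℤ.* + q) + ι (ℤ.- e)     ≡⟨ ι-homo-+ (+ t ℤ.* + q) (ℤ.- e) ⟨
        ι (residual t)                  ∎
      crossℤ : ↥ w ℤ.* + q ≡ residual t ℤ.* ↧ w
      crossℤ = ι-injective (begin
        ι (↥ w ℤ.* + q)          ≡⟨ ι-homo-* (↥ w) (+ q) ⟩
        ι (↥ w) * ℕ→ℚ q          ≡⟨ cong (_* ℕ→ℚ q) (*-denominator w) ⟨
        w * ι (↧ w) * ℕ→ℚ q      ≡⟨ solve 3 (λ w d q → w :* d :* q := w :* q :* d) refl w (ι (↧ w)) (ℕ→ℚ q) ⟩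
        w * ℕ→ℚ q * ι (↧ w)      ≡⟨ cong (_* ι (↧ w)) w*q ⟩
        ι (residual t) * ι (↧ w) ≡⟨ ι-homo-* (residual t) (↧ w) ⟨
        ι (residual t ℤ.* ↧ w)   ∎)

    ∣residual⇒∣numerator : ∀ t → m ℕD.∣ ∣ residual t ∣ → m ℕD.∣ ∣ ↥ (ℕ→ℚ t - c) ∣
    ∣residual⇒∣numerator t m∣f = C.coprime-divisor m⊥q
      (subst (m ℕD.∣_) (trans (sym (cross t)) (ℕₚ.*-comm ∣ ↥ (ℕ→ℚ t - c) ∣ q)) (ℕD.∣m⇒∣m*n (↧ₙ (ℕ→ℚ t - c)) m∣f))

    -- The reduced denominator divides `q`, hence is prime to `m` and can be cancelled from `cross`.
    ∣numerator⇒∣residual : ∀ t → m ℕD.∣ ∣ ↥ (ℕ→ℚ t - c) ∣ → m ℕD.∣ ∣ residual t ∣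
    ∣numerator⇒∣residual t m∣N = C.coprime-divisor m⊥D
      (subst (m ℕD.∣_) (trans (cross t) (ℕₚ.*-comm ∣ residual t ∣ D)) (ℕD.∣m⇒∣m*n q m∣N))
      where
      D = ↧ₙ (ℕ→ℚ t - c)
      D∣q : D ℕD.∣ q
      D∣q = C.coprime-divisor (C.sym (numerator⊥denominator (ℕ→ℚ t - c))) (ℕD.divides ∣ residual t ∣ (cross t))
      m⊥D : Coprime m D
      m⊥D (d∣m , d∣D) = m⊥q (d∣m , ℕD.∣-trans d∣D D∣q)

    -- The two residuals differ by q (t - j), so `m`, being prime to `q`, would divide t - j, which
    -- lies strictly between 0 and `m`.
    residual-unique : ∀ {j t} → j < t → t < m → m ℕD.∣ ∣ residual j ∣ → ¬ m ℕD.∣ ∣ residual t ∣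
    residual-unique {j} {t} j<t t<m m∣fj m∣ft = ℕₚ.<⇒≱ (ℕₚ.≤-<-trans (ℕₚ.m∸n≤m t j) t<m)
      (ℕD.∣⇒≤ {{ℕ.>-nonZero (ℕₚ.m<n⇒0<n∸m j<t)}} (C.coprime-divisor m⊥q m∣qd))
      where
      d = t ∸ j
      difference : residual t ℤ.- residual j ≡ + (q ℕ.* d)
      difference = begin
        (+ t ℤ.* + q ℤ.- e) ℤ.- (+ j ℤ.* + q ℤ.- e)
          ≡⟨ cong (λ t → (+ t ℤ.* + q ℤ.- e) ℤ.- (+ j ℤ.* + q ℤ.- e)) (ℕₚ.m∸n+n≡m (ℕₚ.<⇒≤ j<t)) ⟨
        ((+ d ℤ.+ + j) ℤ.* + q ℤ.- e) ℤ.- (+ j ℤ.* + q ℤ.- e)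
          ≡⟨ ℤSolver.solve 4 (λ d j q e → ((d ℤSolver.:+ j) ℤSolver.:* q ℤSolver.:- e) ℤSolver.:- (j ℤSolver.:* q ℤSolver.:- e) ℤSolver.:= q ℤSolver.:* d) refl (+ d) (+ j) (+ q) e ⟩
        + q ℤ.* + d
          ≡⟨ ℤₚ.pos-* q d ⟨
        + (q ℕ.* d) ∎
      m∣qd : m ℕD.∣ q ℕ.* d
      m∣qd = subst (λ k → m ℕD.∣ ∣ k ∣) difference
        (ℤD.∣⇒∣ᵤ {+ m} {residual t ℤ.- residual j} (ℤD.∣m∣n⇒∣m-n (ℤD.∣ᵤ⇒∣ {+ m} {residual t} m∣ft) (ℤD.∣ᵤ⇒∣ {+ m} {residual j} m∣fj)))

  resMod-unique : ∀ {t} → t < m → m ℕD.∣ ∣ + t ℤ.* + q ℤ.- e ∣ → resMod m c ≡ t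
  resMod-unique {t} t<m m∣f = firstFrom-least (λ t → does (m ℕD.∣? ∣ ↥ (ℕ→ℚ t - c) ∣)) 0 m t t<m
    (dec-true (m ℕD.∣? _) (∣residual⇒∣numerator t m∣f))
    (λ j j<t → dec-false (m ℕD.∣? _) λ m∣N → residual-unique j<t t<m (∣numerator⇒∣residual j m∣N) m∣f)

solve-congruence : ∀ {m p} r → .{{_ : ℕ.NonZero p}} → Coprime m p → ∃[ a ] a < p × ∃[ s ] s ℕ.* p ≡ r ℕ.+ a ℕ.* m
solve-congruence {m} {p} r m⊥p = a , m%n<n a₀ p , ℕD.quotient p∣r+am , sym (ℕD.m∣n⇒n≡quotient*m p∣r+am)
  where
  unreduced : Bézout.Identity 1 m p → ∃[ a₀ ] p ℕD.∣ r ℕ.+ a₀ ℕ.* m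
  -- Here x inverts m modulo p, so -r x is wanted; the factor p - 1 stands for -1 within ℕ.
  unreduced (Bézout.+- x y 1+yp≡xm) = ℕ.pred p ℕ.* r ℕ.* x , ℕD.divides (r ℕ.+ ℕ.pred p ℕ.* r ℕ.* y) (begin
    r ℕ.+ ℕ.pred p ℕ.* r ℕ.* x ℕ.* m
      ≡⟨ cong (r ℕ.+_) (trans (ℕₚ.*-assoc (ℕ.pred p ℕ.* r) x m) (cong (ℕ.pred p ℕ.* r ℕ.*_) (sym 1+yp≡xm))) ⟩
    r ℕ.+ ℕ.pred p ℕ.* r ℕ.* (1 ℕ.+ y ℕ.* p)
      ≡⟨ ℕSolver.solve 4 (λ r n y p → r ℕSolver.:+ n ℕSolver.:* r ℕSolver.:* (ℕSolver.con 1 ℕSolver.:+ y ℕSolver.:* p)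
           ℕSolver.:= r ℕSolver.:* (ℕSolver.con 1 ℕSolver.:+ n) ℕSolver.:+ n ℕSolver.:* r ℕSolver.:* y ℕSolver.:* p) refl r (ℕ.pred p) y p ⟩
    r ℕ.* suc (ℕ.pred p) ℕ.+ ℕ.pred p ℕ.* r ℕ.* y ℕ.* p
      ≡⟨ cong (λ q → r ℕ.* q ℕ.+ ℕ.pred p ℕ.* r ℕ.* y ℕ.* p) (ℕₚ.suc-pred p) ⟩
    r ℕ.* p ℕ.+ ℕ.pred p ℕ.* r ℕ.* y ℕ.* p
      ≡⟨ ℕₚ.*-distribʳ-+ p r (ℕ.pred p ℕ.* r ℕ.* y) ⟨
    (r ℕ.+ ℕ.pred p ℕ.* r ℕ.* y) ℕ.* p ∎)
  -- Here x m ≡ -1 modulo p, so r x already has the right sign.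
  unreduced (Bézout.-+ x y 1+xm≡yp) = r ℕ.* x , ℕD.divides (r ℕ.* y) (begin
    r ℕ.+ r ℕ.* x ℕ.* m     ≡⟨ ℕSolver.solve 3 (λ r x m → r ℕSolver.:+ r ℕSolver.:* x ℕSolver.:* m ℕSolver.:= r ℕSolver.:* (ℕSolver.con 1 ℕSolver.:+ x ℕSolver.:* m)) refl r x m ⟩
    r ℕ.* (1 ℕ.+ x ℕ.* m)   ≡⟨ cong (r ℕ.*_) 1+xm≡yp ⟩
    r ℕ.* (y ℕ.* p)         ≡⟨ ℕₚ.*-assoc r y p ⟨
    r ℕ.* y ℕ.* p           ∎)
  a₀ = proj₁ (unreduced (C.coprime-Bézout m⊥p))
  a = a₀ % p
  p∣r+am : p ℕD.∣ r ℕ.+ a ℕ.* m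
  p∣r+am = ℕD.∣m+n∣m⇒∣n (subst (p ℕD.∣_) (begin
    r ℕ.+ a₀ ℕ.* m
      ≡⟨ cong (λ a₀ → r ℕ.+ a₀ ℕ.* m) (m≡m%n+[m/n]*n a₀ p) ⟩
    r ℕ.+ (a ℕ.+ a₀ / p ℕ.* p) ℕ.* m
      ≡⟨ ℕSolver.solve 5 (λ r a b p m → r ℕSolver.:+ (a ℕSolver.:+ b ℕSolver.:* p) ℕSolver.:* m ℕSolver.:= p ℕSolver.:* (b ℕSolver.:* m) ℕSolver.:+ (r ℕSolver.:+ a ℕSolver.:* m)) refl r a (a₀ / p) p m ⟩
    p ℕ.* (a₀ / p ℕ.* m) ℕ.+ (r ℕ.+ a ℕ.* m) ∎) (proj₂ (unreduced (C.coprime-Bézout m⊥p))))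
    (ℕD.m∣m*n (a₀ / p ℕ.* m))

prime-odd : ∀ {p} → Prime p → 2 < p → ∃[ h ] p ≡ suc (h ℕ.+ h)
prime-odd {p} p-prime 2<p = p / 2 , trans (m≡m%n+[m/n]*n p 2) (cong₂ ℕ._+_ (odd (p % 2) refl (m%n<n p 2)) double)
  where
  double : p / 2 ℕ.* 2 ≡ p / 2 ℕ.+ p / 2
  double = trans (ℕₚ.*-comm (p / 2) 2) (cong (p / 2 ℕ.+_) (ℕₚ.+-identityʳ (p / 2)))
  odd : ∀ b → p % 2 ≡ b → b < 2 → p % 2 ≡ 1
  odd 0 p%2≡0 _ = [ (λ ()) , (λ 2≡p → contradiction 2≡p (ℕₚ.<⇒≢ 2<p)) ]′ (prime⇒irreducible p-prime (ℕD.m%n≡0⇒n∣m p 2 p%2≡0))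
  odd 1 p%2≡1 _ = p%2≡1
  odd (suc (suc _)) _ (s<s (s<s ()))

-- The two sums and their exact shift identities

term : ℚ → ℕ → ℚ
term x k = poch x k * poch (1ℚ - x) k * (recip! k * recip! k)

-- G x n is the product of 1 - x²/k² over k ≤ n (see G-suc).
F S G : ℚ → ℕ → ℚ
F x n = sum1to n λ k → term x k * recip k
S x n = sum1to n λ k → term x k * (recip k * recip k)
G x k = poch (1ℚ + x) k * poch (1ℚ - x) k * (recip! k * recip! k)

-- Apart from the end factors x and K - x, the two Pochhammer symbols consist of the factors that
-- form `G x k`. `term-shift` has the same shape with -x and K + x, so both terms are multiples of
-- one `G x k` and can be subtracted.
term-suc : ∀ x k → let K = ℕ→ℚ (suc k); i = recip (suc k) in
  term x (suc k) ≡ x * (K - x) * (i * i) * G x k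
term-suc x k = begin
  poch x (suc k) * (poch (1ℚ - x) k * (1ℚ - x + ℕ→ℚ k)) * (recip! k * i * (recip! k * i))
    ≡⟨ cong (λ P → P * (poch (1ℚ - x) k * (1ℚ - x + ℕ→ℚ k)) * (recip! k * i * (recip! k * i))) (poch-suc x k) ⟩
  x * P * (P′ * (1ℚ - x + ℕ→ℚ k)) * (recip! k * i * (recip! k * i))
    ≡⟨ solve 6 (λ x P P′ k f i → x :* P :* (P′ :* (con 1ℚ :- x :+ k)) :* (f :* i :* (f :* i))
         := x :* ((con 1ℚ :+ k) :- x) :* (i :* i) :* (P :* P′ :* (f :* f)))
         refl x P P′ (ℕ→ℚ k) (recip! k) i ⟩
  x * ((1ℚ + ℕ→ℚ k) - x) * (i * i) * G x k
    ≡⟨ cong (λ K → x * (K - x) * (i * i) * G x k) (ℕ→ℚ-suc k) ⟨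
  x * (ℕ→ℚ (suc k) - x) * (i * i) * G x k ∎
  where
  i = recip (suc k)
  P = poch (1ℚ + x) k
  P′ = poch (1ℚ - x) k

poch-reflect-shift : ∀ x k → poch (1ℚ - (1ℚ + x)) (suc k) ≡ - x * poch (1ℚ - x) k
poch-reflect-shift x k = trans (poch-suc (1ℚ - (1ℚ + x)) k)
  (cong₂ (λ u v → u * poch v k)
    (solve 1 (λ x → con 1ℚ :- (con 1ℚ :+ x) := :- x) refl x)
    (solve 1 (λ x → con 1ℚ :+ (con 1ℚ :- (con 1ℚ :+ x)) := con 1ℚ :- x) refl x))

term-shift : ∀ x k → let K = ℕ→ℚ (suc k); i = recip (suc k) in
  term (1ℚ + x) (suc k) ≡ - x * (K + x) * (i * i) * G x k
term-shift x k = begin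
  P * (1ℚ + x + ℕ→ℚ k) * poch (1ℚ - (1ℚ + x)) (suc k) * (recip! k * i * (recip! k * i))
    ≡⟨ cong (λ Q → P * (1ℚ + x + ℕ→ℚ k) * Q * (recip! k * i * (recip! k * i))) (poch-reflect-shift x k) ⟩
  P * (1ℚ + x + ℕ→ℚ k) * (- x * P′) * (recip! k * i * (recip! k * i))
    ≡⟨ solve 6 (λ x P P′ k f i → P :* (con 1ℚ :+ x :+ k) :* (:- x :* P′) :* (f :* i :* (f :* i))
         := :- x :* ((con 1ℚ :+ k) :+ x) :* (i :* i) :* (P :* P′ :* (f :* f)))
         refl x P P′ (ℕ→ℚ k) (recip! k) i ⟩
  - x * ((1ℚ + ℕ→ℚ k) + x) * (i * i) * G x k
    ≡⟨ cong (λ K → - x * (K + x) * (i * i) * G x k) (ℕ→ℚ-suc k) ⟨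
  - x * (ℕ→ℚ (suc k) + x) * (i * i) * G x k ∎
  where
  i = recip (suc k)
  P = poch (1ℚ + x) k
  P′ = poch (1ℚ - x) k

G-suc : ∀ x k → let i = recip (suc k) in G x (suc k) ≡ G x k * (1ℚ - x * x * (i * i))
G-suc x k = begin
  P * (1ℚ + x + ℕ→ℚ k) * (P′ * (1ℚ - x + ℕ→ℚ k)) * (recip! k * i * (recip! k * i))
    ≡⟨ solve 6 (λ x P P′ k f i → P :* (con 1ℚ :+ x :+ k) :* (P′ :* (con 1ℚ :- x :+ k)) :* (f :* i :* (f :* i))
         := P :* P′ :* (f :* f) :* (((con 1ℚ :+ k) :* i) :* ((con 1ℚ :+ k) :* i) :- x :* x :* (i :* i)))
         refl x P P′ (ℕ→ℚ k) (recip! k) i ⟩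
  G x k * (((1ℚ + ℕ→ℚ k) * i) * ((1ℚ + ℕ→ℚ k) * i) - x * x * (i * i))
    ≡⟨ cong (λ K → G x k * ((K * i) * (K * i) - x * x * (i * i))) (ℕ→ℚ-suc k) ⟨
  G x k * ((ℕ→ℚ (suc k) * i) * (ℕ→ℚ (suc k) * i) - x * x * (i * i))
    ≡⟨ cong (λ e → G x k * (e * e - x * x * (i * i))) (*-recip (suc k)) ⟩
  G x k * (1ℚ - x * x * (i * i)) ∎
  where
  i = recip (suc k)
  P = poch (1ℚ + x) k
  P′ = poch (1ℚ - x) k

-- By `term-suc` and `term-shift`, the summand with index K contributes -2 (x²/K²) G on the left,
-- where G is the product up to K - 1; this is twice the increment of G.
F-shift : ∀ x n → x * (F (1ℚ + x) n - F x n) ≡ 2ℚ * (G x n - 1ℚ)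
F-shift x zero = solve 1 (λ x → x :* (con 0ℚ :- con 0ℚ) := con 2ℚ :* (con 1ℚ :- con 1ℚ)) refl x
F-shift x (suc n) = begin
  x * ((F (1ℚ + x) n + term (1ℚ + x) (suc n) * i) - (F x n + term x (suc n) * i))
    ≡⟨ cong₂ (λ s t → x * ((F (1ℚ + x) n + s * i) - (F x n + t * i))) (term-shift x n) (term-suc x n) ⟩
  x * ((F (1ℚ + x) n + - x * (K + x) * (i * i) * g * i) - (F x n + x * (K - x) * (i * i) * g * i))
    ≡⟨ solve 6 (λ x A B K i g → x :* ((A :+ :- x :* (K :+ x) :* (i :* i) :* g :* i) :- (B :+ x :* (K :- x) :* (i :* i) :* g :* i))
         := x :* (A :- B) :- con 2ℚ :* (x :* x :* (i :* i) :* g :* (K :* i)))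
         refl x (F (1ℚ + x) n) (F x n) K i g ⟩
  x * (F (1ℚ + x) n - F x n) - 2ℚ * (x * x * (i * i) * g * (K * i))
    ≡⟨ cong₂ (λ s e → s - 2ℚ * (x * x * (i * i) * g * e)) (F-shift x n) (*-recip (suc n)) ⟩
  2ℚ * (g - 1ℚ) - 2ℚ * (x * x * (i * i) * g * 1ℚ)
    ≡⟨ solve 3 (λ x i g → con 2ℚ :* (g :- con 1ℚ) :- con 2ℚ :* (x :* x :* (i :* i) :* g :* con 1ℚ)
         := con 2ℚ :* (g :* (con 1ℚ :- x :* x :* (i :* i)) :- con 1ℚ)) refl x i g ⟩
  2ℚ * (g * (1ℚ - x * x * (i * i)) - 1ℚ)
    ≡⟨ cong (λ h → 2ℚ * (h - 1ℚ)) (G-suc x n) ⟨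
  2ℚ * (G x (suc n) - 1ℚ) ∎
  where
  K = ℕ→ℚ (suc n)
  i = recip (suc n)
  g = G x n

-- The summand with index K contributes -2 (x³/K³) G on the left. On the right, x times the new
-- summand of F is (x²/K²) G - (x³/K³) G, and the increment -(x²/K²) G of G cancels the first part.
S-shift : ∀ x n → x * x * (S (1ℚ + x) n - S x n) ≡ 2ℚ * (x * F x n - (1ℚ - G x n))
S-shift x zero = solve 1 (λ x → x :* x :* (con 0ℚ :- con 0ℚ) := con 2ℚ :* (x :* con 0ℚ :- (con 1ℚ :- con 1ℚ))) refl x
S-shift x (suc n) = begin
  x * x * ((S (1ℚ + x) n + term (1ℚ + x) (suc n) * (i * i)) - (S x n + term x (suc n) * (i * i)))
    ≡⟨ cong₂ (λ s t → x * x * ((S (1ℚ + x) n + s * (i * i)) - (S x n + t * (i * i)))) (term-shift x n) (term-suc x n) ⟩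
  x * x * ((S (1ℚ + x) n + - x * (K + x) * (i * i) * g * (i * i)) - (S x n + x * (K - x) * (i * i) * g * (i * i)))
    ≡⟨ solve 6 (λ x A B K i g → x :* x :* ((A :+ :- x :* (K :+ x) :* (i :* i) :* g :* (i :* i)) :- (B :+ x :* (K :- x) :* (i :* i) :* g :* (i :* i)))
         := x :* x :* (A :- B) :- con 2ℚ :* (x :* x :* x :* (i :* i) :* g :* i :* (K :* i)))
         refl x (S (1ℚ + x) n) (S x n) K i g ⟩
  x * x * (S (1ℚ + x) n - S x n) - 2ℚ * (x * x * x * (i * i) * g * i * (K * i))
    ≡⟨ cong₂ (λ s e → s - 2ℚ * (x * x * x * (i * i) * g * i * e)) (S-shift x n) (*-recip (suc n)) ⟩
  2ℚ * (x * F x n - (1ℚ - g)) - 2ℚ * (x * x * x * (i * i) * g * i * 1ℚ)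
    ≡⟨ solve 4 (λ x f i g → con 2ℚ :* (x :* f :- (con 1ℚ :- g)) :- con 2ℚ :* (x :* x :* x :* (i :* i) :* g :* i :* con 1ℚ)
         := con 2ℚ :* (x :* f :+ x :* x :* (i :* i) :* g :* (con 1ℚ :- x :* i) :- (con 1ℚ :- g :* (con 1ℚ :- x :* x :* (i :* i))))) refl x (F x n) i g ⟩
  2ℚ * (x * F x n + x * x * (i * i) * g * (1ℚ - x * i) - (1ℚ - g * (1ℚ - x * x * (i * i))))
    ≡⟨ cong₂ (λ e h → 2ℚ * (x * F x n + x * x * (i * i) * g * (e - x * i) - (1ℚ - h))) (*-recip (suc n)) (G-suc x n) ⟨
  2ℚ * (x * F x n + x * x * (i * i) * g * (K * i - x * i) - (1ℚ - G x (suc n)))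
    ≡⟨ cong (λ f → 2ℚ * (f - (1ℚ - G x (suc n))))
         (solve 5 (λ x f i g K → x :* f :+ x :* x :* (i :* i) :* g :* (K :* i :- x :* i)
           := x :* (f :+ x :* (K :- x) :* (i :* i) :* g :* i)) refl x (F x n) i g K) ⟩
  2ℚ * (x * (F x n + x * (K - x) * (i * i) * g * i) - (1ℚ - G x (suc n)))
    ≡⟨ cong (λ t → 2ℚ * (x * (F x n + t * i) - (1ℚ - G x (suc n)))) (term-suc x n) ⟨
  2ℚ * (x * F x (suc n) - (1ℚ - G x (suc n))) ∎
  where
  K = ℕ→ℚ (suc n)
  i = recip (suc n)
  g = G x n
-- For `n = p` this is the part of 1 - p Q that varies along the walk.
W : ℚ → ℕ → ℚ
W x n = poch x n * poch (1ℚ - x) n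

-- Only end factors change: (1 + x)ₙ x = (x)ₙ (x + n) and (-x)ₙ (n - x) = -x (1 - x)ₙ. Both are kept
-- multiplied out, so that no factor has to be nonzero.
W-shift : ∀ x n → W (1ℚ + x) n * (x * (ℕ→ℚ n - x)) ≡ W x n * (x + ℕ→ℚ n) * - x
W-shift x n = begin
  P₁ * Q * (x * (ℕ→ℚ n - x))
    ≡⟨ solve 4 (λ x P₁ Q n → P₁ :* Q :* (x :* (n :- x)) := (x :* P₁) :* (Q :* (con 1ℚ :- (con 1ℚ :+ x) :+ n)))
         refl x P₁ Q (ℕ→ℚ n) ⟩
  x * P₁ * poch (1ℚ - (1ℚ + x)) (suc n)
    ≡⟨ cong₂ _*_ (sym (poch-suc x n)) (poch-reflect-shift x n) ⟩
  P * (x + ℕ→ℚ n) * (- x * P′)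
    ≡⟨ solve 4 (λ x P P′ n → P :* (x :+ n) :* (:- x :* P′) := P :* P′ :* (x :+ n) :* :- x)
         refl x P P′ (ℕ→ℚ n) ⟩
  P * P′ * (x + ℕ→ℚ n) * - x ∎
  where
  P = poch x n
  P′ = poch (1ℚ - x) n
  P₁ = poch (1ℚ + x) n
  Q = poch (1ℚ - (1ℚ + x)) n

-- Rearranging finite sums

sum1to-cong : ∀ {f g} n → (∀ k → 0 < k → k ≤ n → f k ≡ g k) → sum1to n f ≡ sum1to n g
sum1to-cong zero f≗g = refl
sum1to-cong (suc n) f≗g = cong₂ _+_ (sum1to-cong n λ k 0<k k≤n → f≗g k 0<k (ℕₚ.m≤n⇒m≤1+n k≤n)) (f≗g (suc n) z<s ℕₚ.≤-refl)

sum1to-+ : ∀ m n f → sum1to (m ℕ.+ n) f ≡ sum1to m f + sum1to n λ k → f (m ℕ.+ k)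
sum1to-+ m zero f = trans (cong (λ k → sum1to k f) (ℕₚ.+-identityʳ m)) (sym (ℚₚ.+-identityʳ (sum1to m f)))
sum1to-+ m (suc n) f = begin
  sum1to (m ℕ.+ suc n) f                       ≡⟨ cong (λ k → sum1to k f) (ℕₚ.+-suc m n) ⟩
  sum1to (m ℕ.+ n) f + f (suc (m ℕ.+ n))       ≡⟨ cong₂ (λ s k → s + f k) (sum1to-+ m n f) (sym (ℕₚ.+-suc m n)) ⟩
  sum1to m f + sum1to n f′ + f (m ℕ.+ suc n)   ≡⟨ ℚₚ.+-assoc (sum1to m f) (sum1to n f′) (f (m ℕ.+ suc n)) ⟩
  sum1to m f + (sum1to n f′ + f (m ℕ.+ suc n)) ∎
  where
  f′ : ℕ → ℚ
  f′ k = f (m ℕ.+ k)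

sum1to-reverse : ∀ n f → sum1to n f ≡ sum1to n λ k → f (suc n ∸ k)
sum1to-reverse zero f = refl
sum1to-reverse (suc n) f = begin
  sum1to (suc n) f                          ≡⟨ sum1to-+ 1 n f ⟩
  0ℚ + f 1 + sum1to n (f ∘ suc)             ≡⟨ solve 2 (λ a b → con 0ℚ :+ a :+ b := b :+ a) refl (f 1) (sum1to n (f ∘ suc)) ⟩
  sum1to n (f ∘ suc) + f 1                  ≡⟨ cong (_+ f 1) (sum1to-reverse n (f ∘ suc)) ⟩
  sum1to n (λ k → f (suc (suc n ∸ k))) + f 1
    ≡⟨ cong₂ _+_ (sum1to-cong n λ k _ k≤n → cong f (sym (ℕₚ.+-∸-assoc 1 (ℕₚ.m≤n⇒m≤1+n k≤n))))
                 (cong f (sym (ℕₚ.m+n∸n≡m 1 (suc n)))) ⟩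
  sum1to n (λ k → f (suc (suc n) ∸ k)) + f (suc (suc n) ∸ suc n) ∎

sum1to-parity : ∀ n f → sum1to (n ℕ.+ n) f ≡ sum1to n (λ k → f (k ℕ.+ k)) + sum1to n λ k → f (k ℕ.+ k ∸ 1)
sum1to-parity zero f = refl
sum1to-parity (suc n) f = begin
  sum1to (n ℕ.+ suc n) f + f (suc n ℕ.+ suc n)
    ≡⟨ cong (λ k → sum1to k f + f (suc n ℕ.+ suc n)) (ℕₚ.+-suc n n) ⟩
  sum1to (n ℕ.+ n) f + f (suc (n ℕ.+ n)) + f (suc n ℕ.+ suc n)
    ≡⟨ cong₂ (λ s k → s + f k + f (suc n ℕ.+ suc n)) (sum1to-parity n f) (sym (ℕₚ.+-suc n n)) ⟩
  e + o + f (n ℕ.+ suc n) + f (suc n ℕ.+ suc n)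
    ≡⟨ solve 4 (λ e o a b → e :+ o :+ a :+ b := (e :+ b) :+ (o :+ a)) refl e o (f (n ℕ.+ suc n)) (f (suc n ℕ.+ suc n)) ⟩
  (e + f (suc n ℕ.+ suc n)) + (o + f (n ℕ.+ suc n)) ∎
  where
  e = sum1to n λ k → f (k ℕ.+ k)
  o = sum1to n λ k → f (k ℕ.+ k ∸ 1)

sum1to-*ˡ : ∀ c n f → sum1to n (λ k → c * f k) ≡ c * sum1to n f
sum1to-*ˡ c zero f = sym (ℚₚ.*-zeroʳ c)
sum1to-*ˡ c (suc n) f = trans (cong (_+ c * f (suc n)) (sum1to-*ˡ c n f)) (sym (ℚₚ.*-distribˡ-+ c (sum1to n f) (f (suc n))))

recip² : ℕ → ℚ
recip² k = recip k * recip k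

recip-double : ∀ k → .{{ℕ.NonZero k}} → recip² k ≡ 2ℚ * 2ℚ * recip² (k ℕ.+ k)
recip-double k@(suc k-1) = begin
  i * i                                      ≡⟨ solve 1 (λ i → i :* i := con 1ℚ :* i :* (con 1ℚ :* i)) refl i ⟩
  1ℚ * i * (1ℚ * i)                          ≡⟨ cong (λ e → e * i * (e * i)) (*-recip (k ℕ.+ k)) ⟨
  ℕ→ℚ (k ℕ.+ k) * j * i * (ℕ→ℚ (k ℕ.+ k) * j * i) ≡⟨ cong (λ a → a * j * i * (a * j * i)) (ℕ→ℚ-homo-+ k k) ⟩
  (K + K) * j * i * ((K + K) * j * i)
    ≡⟨ solve 3 (λ K i j → (K :+ K) :* j :* i :* ((K :+ K) :* j :* i) := con 2ℚ :* con 2ℚ :* ((K :* i :* j) :* (K :* i :* j))) refl K i j ⟩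
  2ℚ * 2ℚ * ((K * i * j) * (K * i * j))      ≡⟨ cong (λ e → 2ℚ * 2ℚ * ((e * j) * (e * j))) (*-recip k) ⟩
  2ℚ * 2ℚ * ((1ℚ * j) * (1ℚ * j))            ≡⟨ solve 1 (λ j → con 2ℚ :* con 2ℚ :* ((con 1ℚ :* j) :* (con 1ℚ :* j)) := con 2ℚ :* con 2ℚ :* (j :* j)) refl j ⟩
  2ℚ * 2ℚ * (j * j)                          ∎
  where
  K = ℕ→ℚ k
  i = recip k
  j = recip (k ℕ.+ k)

-- The localisation of ℤ at p

module _ (p : ℕ) (p-prime : Prime p) where

  private instance
    p-nonZero : ℕ.NonZero p
    p-nonZero = prime⇒nonZero p-prime

  p∤* : ∀ {a b} → ¬ p ℕD.∣ a → ¬ p ℕD.∣ b → ¬ p ℕD.∣ a ℕ.* b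
  p∤* {a} {b} p∤a p∤b p∣ab = [ p∤a , p∤b ]′ (euclidsLemma a b p-prime p∣ab)

  p∤1 : ¬ p ℕD.∣ 1
  p∤1 p∣1 = ℕ.nonTrivial⇒≢1 {{prime⇒nonTrivial p-prime}} (ℕD.∣1⇒≡1 p∣1)

  -- Euclid's lemma moves one factor p at a time into `n`, since `d` can absorb none.
  p^s∣-cancelʳ : ∀ s {n d} → ¬ p ℕD.∣ d → p ℕ.^ s ℕD.∣ n ℕ.* d → p ℕ.^ s ℕD.∣ n
  p^s∣-cancelʳ zero {n} p∤d _ = ℕD.1∣ n
  p^s∣-cancelʳ (suc s) {n} {d} p∤d pp^s∣nd with euclidsLemma n d p-prime (ℕD.∣-trans (ℕD.m∣m*n (p ℕ.^ s)) pp^s∣nd)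
  ... | inj₂ p∣d = contradiction p∣d p∤d
  ... | inj₁ (ℕD.divides k refl) = subst (p ℕ.* p ℕ.^ s ℕD.∣_) (ℕₚ.*-comm p k)
    (ℕD.*-monoʳ-∣ p (p^s∣-cancelʳ s p∤d (ℕD.*-cancelˡ-∣ p
      (subst (p ℕ.* p ℕ.^ s ℕD.∣_) (trans (cong (ℕ._* d) (ℕₚ.*-comm k p)) (ℕₚ.*-assoc p k d)) pp^s∣nd))))

  -- The fraction need not be reduced: any denominator prime to p is a witness, so closure under
  -- ring operations requires no greatest common divisors.
  record Integral (q : ℚ) : Set where
    constructor mkIntegral
    field
      num den : ℤ
      p∤den : ¬ p ℕD.∣ ∣ den ∣
      *-den : q * ι den ≡ ι num

  open Integral

  ι-integral : ∀ a → Integral (ι a)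
  ι-integral a = mkIntegral a ℤ.1ℤ p∤1 (ℚₚ.*-identityʳ (ι a))

  ℕ→ℚ-integral : ∀ n → Integral (ℕ→ℚ n)
  ℕ→ℚ-integral n = ι-integral (+ n)

  1-integral : Integral 1ℚ
  1-integral = ι-integral ℤ.1ℤ

  private
    p∤den* : ∀ {q r} (i : Integral q) (j : Integral r) → ¬ p ℕD.∣ ∣ den i ℤ.* den j ∣
    p∤den* i j = subst (¬_ ∘ (p ℕD.∣_)) (sym (ℤₚ.abs-* (den i) (den j))) (p∤* (p∤den i) (p∤den j))

  +-integral : ∀ {q r} → Integral q → Integral r → Integral (q + r)
  +-integral {q} {r} i j = mkIntegral (num i ℤ.* den j ℤ.+ den i ℤ.* num j) (den i ℤ.* den j) (p∤den* i j) (begin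
    (q + r) * ι (den i ℤ.* den j)         ≡⟨ cong ((q + r) *_) (ι-homo-* (den i) (den j)) ⟩
    (q + r) * (ι (den i) * ι (den j))
      ≡⟨ solve 4 (λ q r a b → (q :+ r) :* (a :* b) := q :* a :* b :+ a :* (r :* b)) refl q r (ι (den i)) (ι (den j)) ⟩
    q * ι (den i) * ι (den j) + ι (den i) * (r * ι (den j))
      ≡⟨ cong₂ (λ u v → u * ι (den j) + ι (den i) * v) (*-den i) (*-den j) ⟩
    ι (num i) * ι (den j) + ι (den i) * ι (num j)
      ≡⟨ cong₂ _+_ (ι-homo-* (num i) (den j)) (ι-homo-* (den i) (num j)) ⟨
    ι (num i ℤ.* den j) + ι (den i ℤ.* num j)
      ≡⟨ ι-homo-+ (num i ℤ.* den j) (den i ℤ.* num j) ⟨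
    ι (num i ℤ.* den j ℤ.+ den i ℤ.* num j) ∎)

  *-integral : ∀ {q r} → Integral q → Integral r → Integral (q * r)
  *-integral {q} {r} i j = mkIntegral (num i ℤ.* num j) (den i ℤ.* den j) (p∤den* i j) (begin
    (q * r) * ι (den i ℤ.* den j)         ≡⟨ cong ((q * r) *_) (ι-homo-* (den i) (den j)) ⟩
    (q * r) * (ι (den i) * ι (den j))
      ≡⟨ solve 4 (λ q r a b → (q :* r) :* (a :* b) := q :* a :* (r :* b)) refl q r (ι (den i)) (ι (den j)) ⟩
    q * ι (den i) * (r * ι (den j))       ≡⟨ cong₂ _*_ (*-den i) (*-den j) ⟩
    ι (num i) * ι (num j)                 ≡⟨ ι-homo-* (num i) (num j) ⟨
    ι (num i ℤ.* num j)                   ∎)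

  neg-integral : ∀ {q} → Integral q → Integral (- q)
  neg-integral {q} i = mkIntegral (ℤ.- num i) (den i) (p∤den i) (begin
    - q * ι (den i)     ≡⟨ ℚₚ.neg-distribˡ-* q (ι (den i)) ⟨
    - (q * ι (den i))   ≡⟨ cong -_ (*-den i) ⟩
    - ι (num i)         ≡⟨ ι-homo-neg (num i) ⟨
    ι (ℤ.- num i)       ∎)

  -‿integral : ∀ {q r} → Integral q → Integral r → Integral (q - r)
  -‿integral i j = +-integral i (neg-integral j)

  unit-integral : ∀ {q a} (i : Integral q) → q * a ≡ 1ℚ → ¬ p ℕD.∣ ∣ num i ∣ → Integral a
  unit-integral {q} {a} i qa≡1 p∤num = mkIntegral (den i) (num i) p∤num (begin
    a * ι (num i)          ≡⟨ cong (a *_) (*-den i) ⟨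
    a * (q * ι (den i))    ≡⟨ solve 3 (λ a q d → a :* (q :* d) := q :* a :* d) refl a q (ι (den i)) ⟩
    q * a * ι (den i)      ≡⟨ cong (_* ι (den i)) qa≡1 ⟩
    1ℚ * ι (den i)         ≡⟨ ℚₚ.*-identityˡ (ι (den i)) ⟩
    ι (den i)              ∎)

  -- Divisibility by powers of p

  π : ℚ
  π = ℕ→ℚ p

  π^_ : ℕ → ℚ
  π^ zero = 1ℚ
  π^ suc s = π * π^ s

  π^≡ : ∀ s → π^ s ≡ ℕ→ℚ (p ℕ.^ s)
  π^≡ zero = refl
  π^≡ (suc s) = trans (cong (π *_) (π^≡ s)) (sym (ℕ→ℚ-homo-* p (p ℕ.^ s)))

  π^-+ : ∀ s t → π^ (s ℕ.+ t) ≡ π^ s * π^ t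
  π^-+ zero t = sym (ℚₚ.*-identityˡ (π^ t))
  π^-+ (suc s) t = trans (cong (π *_) (π^-+ s t)) (sym (ℚₚ.*-assoc π (π^ s) (π^ t)))

  infix 4 _∣ᵖ_

  -- s ∣ᵖ u means that p ^ s divides u in the localisation ℤ₍ₚ₎.
  record _∣ᵖ_ (s : ℕ) (u : ℚ) : Set where
    constructor divides
    field
      quot : ℚ
      quot-integral : Integral quot
      equality : u ≡ π^ s * quot

  ∣ᵖ-+ : ∀ {s u v} → s ∣ᵖ u → s ∣ᵖ v → s ∣ᵖ u + v
  ∣ᵖ-+ {s} (divides q i refl) (divides r j refl) = divides (q + r) (+-integral i j) (sym (ℚₚ.*-distribˡ-+ (π^ s) q r))

  ∣ᵖ-neg : ∀ {s u} → s ∣ᵖ u → s ∣ᵖ - u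
  ∣ᵖ-neg {s} (divides q i refl) = divides (- q) (neg-integral i) (ℚₚ.neg-distribʳ-* (π^ s) q)

  ∣ᵖ-- : ∀ {s u v} → s ∣ᵖ u → s ∣ᵖ v → s ∣ᵖ u - v
  ∣ᵖ-- s∣u s∣v = ∣ᵖ-+ s∣u (∣ᵖ-neg s∣v)

  ∣ᵖ-* : ∀ {s t u v} → s ∣ᵖ u → t ∣ᵖ v → s ℕ.+ t ∣ᵖ u * v
  ∣ᵖ-* {s} {t} (divides q i refl) (divides r j refl) = divides (q * r) (*-integral i j) (begin
    π^ s * q * (π^ t * r)
      ≡⟨ solve 4 (λ a q b r → a :* q :* (b :* r) := a :* b :* (q :* r)) refl (π^ s) q (π^ t) r ⟩
    π^ s * π^ t * (q * r)
      ≡⟨ cong (_* (q * r)) (π^-+ s t) ⟨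
    π^ (s ℕ.+ t) * (q * r) ∎)

  ∣ᵖ-*ʳ : ∀ {s u v} → s ∣ᵖ u → Integral v → s ∣ᵖ u * v
  ∣ᵖ-*ʳ {s} {v = v} (divides q i refl) j = divides (q * v) (*-integral i j) (ℚₚ.*-assoc (π^ s) q v)

  ∣ᵖ-*ˡ : ∀ {s u v} → Integral u → s ∣ᵖ v → s ∣ᵖ u * v
  ∣ᵖ-*ˡ {s} {u} {v} i s∣v = subst (s ∣ᵖ_) (ℚₚ.*-comm v u) (∣ᵖ-*ʳ s∣v i)

  ∣ᵖ-pred : ∀ {s u} → suc s ∣ᵖ u → s ∣ᵖ u
  ∣ᵖ-pred {s} (divides q i refl) = divides (π * q) (*-integral (ℕ→ℚ-integral p) i)
    (solve 3 (λ p a q → p :* a :* q := a :* (p :* q)) refl π (π^ s) q)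

  ∣ᵖ⇒integral : ∀ {s u} → s ∣ᵖ u → Integral u
  ∣ᵖ⇒integral {s} (divides q i refl) = *-integral (subst Integral (sym (π^≡ s)) (ℕ→ℚ-integral (p ℕ.^ s))) i

  1∣ᵖπ : 1 ∣ᵖ π
  1∣ᵖπ = divides 1ℚ 1-integral (solve 1 (λ p → p := p :* con 1ℚ :* con 1ℚ) refl π)

  π*recip-p : π * recip p ≡ 1ℚ
  π*recip-p = *-recip p

  -- Cancelling p costs one power, which is why the walk is controlled modulo p³ while the goal is
  -- modulo p².
  ∣ᵖ-cancel-π : ∀ {s u} → suc s ∣ᵖ π * u → s ∣ᵖ u
  ∣ᵖ-cancel-π {s} {u} (divides q i eq) = divides q i (begin
    u                              ≡⟨ ℚₚ.*-identityˡ u ⟨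
    1ℚ * u                         ≡⟨ cong (_* u) π*recip-p ⟨
    π * recip p * u                ≡⟨ solve 3 (λ p i u → p :* i :* u := i :* (p :* u)) refl π (recip p) u ⟩
    recip p * (π * u)              ≡⟨ cong (recip p *_) eq ⟩
    recip p * (π * π^ s * q)       ≡⟨ solve 4 (λ p i a q → i :* (p :* a :* q) := p :* i :* (a :* q)) refl π (recip p) (π^ s) q ⟩
    π * recip p * (π^ s * q)       ≡⟨ cong (_* (π^ s * q)) π*recip-p ⟩
    1ℚ * (π^ s * q)                ≡⟨ ℚₚ.*-identityˡ (π^ s * q) ⟩
    π^ s * q                       ∎)

  -- Cross-multiplication compares the reduced fraction with the unreduced witness. The witness
  -- denominator is prime to p, so p^s falls on the reduced numerator; the reduced denominator
  -- divides the witness denominator, so p does not divide it.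
  ∣ᵖ⇒≡mod : ∀ {s} u v → s ∣ᵖ u - v → u ≡ v mod p ^ s
  ∣ᵖ⇒≡mod {s} u v (divides q i eq) = p^s∣-cancelʳ s (p∤den i) (ℕD.divides (∣ num i ∣ ℕ.* D) crossℕ′) , p∤D
    where
    w = u - v
    N = ∣ ↥ w ∣
    D = ↧ₙ w

    cross : ↥ w ℤ.* den i ≡ + (p ℕ.^ s) ℤ.* num i ℤ.* ↧ w
    cross = ι-injective (begin
      ι (↥ w ℤ.* den i)                          ≡⟨ ι-homo-* (↥ w) (den i) ⟩
      ι (↥ w) * ι (den i)                        ≡⟨ cong (_* ι (den i)) (*-denominator w) ⟨
      w * ι (↧ w) * ι (den i)                    ≡⟨ cong (λ u → u * ι (↧ w) * ι (den i)) eq ⟩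
      π^ s * q * ι (↧ w) * ι (den i)
        ≡⟨ solve 4 (λ a q D d → a :* q :* D :* d := a :* (q :* d) :* D) refl (π^ s) q (ι (↧ w)) (ι (den i)) ⟩
      π^ s * (q * ι (den i)) * ι (↧ w)           ≡⟨ cong₂ (λ a n → a * n * ι (↧ w)) (π^≡ s) (*-den i) ⟩
      ι (+ (p ℕ.^ s)) * ι (num i) * ι (↧ w)      ≡⟨ cong (_* ι (↧ w)) (ι-homo-* (+ (p ℕ.^ s)) (num i)) ⟨
      ι (+ (p ℕ.^ s) ℤ.* num i) * ι (↧ w)        ≡⟨ ι-homo-* (+ (p ℕ.^ s) ℤ.* num i) (↧ w) ⟨
      ι (+ (p ℕ.^ s) ℤ.* num i ℤ.* ↧ w)          ∎)

    crossℕ : N ℕ.* ∣ den i ∣ ≡ p ℕ.^ s ℕ.* ∣ num i ∣ ℕ.* D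
    crossℕ = begin
      N ℕ.* ∣ den i ∣                              ≡⟨ ℤₚ.abs-* (↥ w) (den i) ⟨
      ∣ ↥ w ℤ.* den i ∣                            ≡⟨ cong ∣_∣ cross ⟩
      ∣ + (p ℕ.^ s) ℤ.* num i ℤ.* ↧ w ∣            ≡⟨ ℤₚ.abs-* (+ (p ℕ.^ s) ℤ.* num i) (↧ w) ⟩
      ∣ + (p ℕ.^ s) ℤ.* num i ∣ ℕ.* D              ≡⟨ cong (ℕ._* D) (ℤₚ.abs-* (+ (p ℕ.^ s)) (num i)) ⟩
      p ℕ.^ s ℕ.* ∣ num i ∣ ℕ.* D                  ∎

    crossℕ′ : N ℕ.* ∣ den i ∣ ≡ ∣ num i ∣ ℕ.* D ℕ.* p ℕ.^ s
    crossℕ′ = trans crossℕ (trans (ℕₚ.*-assoc (p ℕ.^ s) ∣ num i ∣ D) (ℕₚ.*-comm (p ℕ.^ s) (∣ num i ∣ ℕ.* D)))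

    p∤D : ¬ p ℕD.∣ D
    p∤D p∣D = p∤den i (ℕD.∣-trans p∣D (C.coprime-divisor (C.sym (numerator⊥denominator w)) (ℕD.divides (p ℕ.^ s ℕ.* ∣ num i ∣) crossℕ)))

  -- Modulo p the numerator of j + p t is j times the denominator of t, a product of two numbers
  -- prime to p. This also shows that j + p t is nonzero, so that an inverse exists at all.
  p∤⇒unit : ∀ {j t} → ¬ p ℕD.∣ j → Integral t → ∃[ v ] Integral v × (ℕ→ℚ j + π * t) * v ≡ 1ℚ
  p∤⇒unit {j} {t} p∤j i = v , unit-integral a-integral av≡1 p∤num , av≡1
    where
    a = ℕ→ℚ j + π * t
    v = 1ℚ ⊘ a
    n = + j ℤ.* den i ℤ.+ + p ℤ.* num i
    a-integral : Integral a
    a-integral = mkIntegral n (den i) (p∤den i) (begin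
      a * ι (den i)   ≡⟨ solve 4 (λ j p t d → (j :+ p :* t) :* d := j :* d :+ p :* (t :* d)) refl (ℕ→ℚ j) π t (ι (den i)) ⟩
      ℕ→ℚ j * ι (den i) + π * (t * ι (den i))   ≡⟨ cong (λ u → ℕ→ℚ j * ι (den i) + π * u) (*-den i) ⟩
      ι (+ j) * ι (den i) + ι (+ p) * ι (num i)   ≡⟨ cong₂ _+_ (ι-homo-* (+ j) (den i)) (ι-homo-* (+ p) (num i)) ⟨
      ι (+ j ℤ.* den i) + ι (+ p ℤ.* num i)   ≡⟨ ι-homo-+ (+ j ℤ.* den i) (+ p ℤ.* num i) ⟨
      ι n ∎)
    p∤num : ¬ p ℕD.∣ ∣ n ∣
    p∤num p∣n = subst (¬_ ∘ (p ℕD.∣_)) (sym (ℤₚ.abs-* (+ j) (den i))) (p∤* p∤j (p∤den i))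
      (ℤD.∣⇒∣ᵤ {+ p} {+ j ℤ.* den i} (ℤD.∣m+n∣n⇒∣m (ℤD.∣ᵤ⇒∣ {+ p} {n} p∣n) (ℤD.∣m⇒∣m*n (num i) ℤD.∣-refl)))
    a≢0 : a ≢ 0ℚ
    a≢0 a≡0 = p∤num (subst (λ k → p ℕD.∣ ∣ k ∣) (sym n≡0) (p ℕD.∣0))
      where
      n≡0 : n ≡ ℤ.0ℤ
      n≡0 = ι-injective (trans (sym (*-den a-integral)) (trans (cong (_* ι (den i)) a≡0) (ℚₚ.*-zeroˡ (ι (den i)))))
    av≡1 : a * v ≡ 1ℚ
    av≡1 = *-inverse-⊘ a≢0

  ∣ᵖ-sum : ∀ {s f g} n → (∀ k → 0 < k → k ≤ n → s ∣ᵖ f k - g k) → s ∣ᵖ sum1to n f - sum1to n g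
  ∣ᵖ-sum {s} zero _ = divides 0ℚ (ι-integral ℤ.0ℤ) (sym (ℚₚ.*-zeroʳ (π^ s)))
  ∣ᵖ-sum {s} {f} {g} (suc n) s∣f-g = subst (s ∣ᵖ_)
    (solve 4 (λ a b c d → (a :- b) :+ (c :- d) := (a :+ c) :- (b :+ d)) refl (sum1to n f) (sum1to n g) (f (suc n)) (g (suc n)))
    (∣ᵖ-+ (∣ᵖ-sum n λ k 0<k k≤n → s∣f-g k 0<k (ℕₚ.m≤n⇒m≤1+n k≤n)) (s∣f-g (suc n) z<s ℕₚ.≤-refl))

  <⇒p∤ : ∀ {k} → 0 < k → k < p → ¬ p ℕD.∣ k
  <⇒p∤ 0<k k<p p∣k = ℕₚ.<⇒≱ k<p (ℕD.∣⇒≤ {{ℕ.>-nonZero 0<k}} p∣k)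

  recip-integral : ∀ {k} → ¬ p ℕD.∣ k → Integral (recip k)
  recip-integral {zero} p∤0 = contradiction (p ℕD.∣0) p∤0
  recip-integral {k@(suc _)} p∤k = unit-integral (ℕ→ℚ-integral k) (*-recip k) p∤k

  recip<-integral : ∀ {k} → suc k < p → Integral (recip (suc k))
  recip<-integral k<p = recip-integral (<⇒p∤ z<s k<p)

  recip²-integral : ∀ {k} → 0 < k → k < p → Integral (recip² k)
  recip²-integral 0<k k<p = *-integral (recip-integral (<⇒p∤ 0<k k<p)) (recip-integral (<⇒p∤ 0<k k<p))

  recip!-integral : ∀ k → k < p → Integral (recip! k)
  recip!-integral zero _ = 1-integral
  recip!-integral (suc k) k<p = *-integral (recip!-integral k (ℕₚ.<-trans (ℕₚ.n<1+n k) k<p)) (recip<-integral k<p)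

  poch-integral : ∀ {y} k → Integral y → Integral (poch y k)
  poch-integral zero i = 1-integral
  poch-integral (suc k) i = *-integral (poch-integral k i) (+-integral i (ℕ→ℚ-integral k))

  ∣ᵖ-poch : ∀ {s y j} k → Integral y → j < k → s ∣ᵖ y + ℕ→ℚ j → s ∣ᵖ poch y k
  ∣ᵖ-poch (suc k) i j<1+k s∣y+j with ℕₚ.m<1+n⇒m<n∨m≡n j<1+k
  ... | inj₁ j<k = ∣ᵖ-*ʳ (∣ᵖ-poch k i j<k s∣y+j) (+-integral i (ℕ→ℚ-integral k))
  ... | inj₂ refl = ∣ᵖ-*ˡ (poch-integral k i) s∣y+j

  -- The sum of 1/k² modulo p

  -- 1/k² - 1/l² = (k + l) (l - k) / (k² l²), and here k + l is p.
  recip²-reflect : ∀ {k l} → k ℕ.+ l ≡ p → 0 < k → 0 < l → 1 ∣ᵖ recip² k - recip² l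
  recip²-reflect {k} {l} refl 0<k 0<l = subst (1 ∣ᵖ_) (sym eq)
    (∣ᵖ-*ʳ 1∣ᵖπ (*-integral (-‿integral (ℕ→ℚ-integral l) (ℕ→ℚ-integral k)) (*-integral (recip²-integral 0<k k<p) (recip²-integral 0<l l<p))))
    where
    i = recip k
    j = recip l
    K = ℕ→ℚ k
    L = ℕ→ℚ l
    k<p : k < k ℕ.+ l
    k<p = ℕₚ.m<m+n k 0<l
    l<p : l < k ℕ.+ l
    l<p = ℕₚ.m<n+m l 0<k
    eq : recip² k - recip² l ≡ π * ((L - K) * (recip² k * recip² l))
    eq = begin
      i * i - j * j
        ≡⟨ solve 2 (λ i j → i :* i :- j :* j := i :* i :* (con 1ℚ :* con 1ℚ) :- j :* j :* (con 1ℚ :* con 1ℚ)) refl i j ⟩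
      i * i * (1ℚ * 1ℚ) - j * j * (1ℚ * 1ℚ)
        ≡⟨ cong₂ (λ a b → i * i * (a * a) - j * j * (b * b)) (*-recip l {{ℕ.>-nonZero 0<l}}) (*-recip k {{ℕ.>-nonZero 0<k}}) ⟨
      i * i * ((L * j) * (L * j)) - j * j * ((K * i) * (K * i))
        ≡⟨ solve 4 (λ i j K L → i :* i :* ((L :* j) :* (L :* j)) :- j :* j :* ((K :* i) :* (K :* i))
             := (K :+ L) :* ((L :- K) :* (i :* i :* (j :* j)))) refl i j K L ⟩
      (K + L) * ((L - K) * (i * i * (j * j)))
        ≡⟨ cong (_* ((L - K) * (i * i * (j * j)))) (ℕ→ℚ-homo-+ k l) ⟨
      π * ((L - K) * (i * i * (j * j))) ∎

  H² : ℕ → ℚ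
  H² n = sum1to n recip²

  -- Write h′ for the sum of 1/k² over k ≤ h.  Folding k ↔ p - k gives H² ≡ 2 h′;
  -- folding the odd k = p - 2l onto the even 2l gives H² ≡ h′ / 2.  Hence 3 H² ≡ 0.
  H²-divisible : 3 < p → ∀ h → p ≡ suc (h ℕ.+ h) → 1 ∣ᵖ H² (h ℕ.+ h)
  H²-divisible 3<p h p≡2h+1 = subst (1 ∣ᵖ_) (eq (H² (h ℕ.+ h))) (∣ᵖ-*ʳ 3H-divisible (recip-integral {3} (<⇒p∤ z<s 3<p)))
    where
    H = H² (h ℕ.+ h)
    Σ = H² h
    E = sum1to h λ k → recip² (k ℕ.+ k)
    O = sum1to h λ k → recip² (k ℕ.+ k ∸ 1)
    U = sum1to h λ k → recip² (h ℕ.+ k)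

    U≡Σ : 1 ∣ᵖ U - Σ
    -- Reversal turns the index h + k into h + (h + 1 - k), which is p - k.
    U≡Σ = subst (λ s → 1 ∣ᵖ s - Σ) (sym (sum1to-reverse h λ k → recip² (h ℕ.+ k)))
      (∣ᵖ-sum h λ k 0<k k≤h → recip²-reflect (h+[1+h∸k]+k k≤h) (ℕₚ.<-≤-trans (ℕₚ.m<n⇒0<n∸m (s≤s k≤h)) (ℕₚ.m≤n+m _ h)) 0<k)
      where
      h+[1+h∸k]+k : ∀ {k} → k ≤ h → h ℕ.+ (suc h ∸ k) ℕ.+ k ≡ p
      h+[1+h∸k]+k {k} k≤h = trans (ℕₚ.+-assoc h (suc h ∸ k) k)
        (trans (cong (h ℕ.+_) (ℕₚ.m∸n+n≡m (ℕₚ.m≤n⇒m≤1+n k≤h))) (trans (ℕₚ.+-suc h h) (sym p≡2h+1)))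

    O≡E : 1 ∣ᵖ O - E
    O≡E = subst (λ s → 1 ∣ᵖ s - E) (sym (sum1to-reverse h λ k → recip² (k ℕ.+ k ∸ 1)))
      (∣ᵖ-sum h λ k 0<k k≤h → recip²-reflect (eqn k≤h) (pos k≤h) (ℕₚ.<-≤-trans 0<k (ℕₚ.m≤m+n k k)))
      where
      1+h∸k : ∀ {k} → k ≤ h → suc h ∸ k ≡ suc (h ∸ k)
      1+h∸k k≤h = ℕₚ.+-∸-assoc 1 k≤h
      reduce : ∀ {k} → k ≤ h → (suc h ∸ k) ℕ.+ (suc h ∸ k) ∸ 1 ≡ suc ((h ∸ k) ℕ.+ (h ∸ k))
      reduce {k} k≤h = trans (cong (λ d → d ℕ.+ d ∸ 1) (1+h∸k k≤h)) (ℕₚ.+-suc (h ∸ k) (h ∸ k))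
      pos : ∀ {k} → k ≤ h → 0 < (suc h ∸ k) ℕ.+ (suc h ∸ k) ∸ 1
      pos k≤h = subst (0 <_) (sym (reduce k≤h)) z<s
      eqn : ∀ {k} → k ≤ h → (suc h ∸ k) ℕ.+ (suc h ∸ k) ∸ 1 ℕ.+ (k ℕ.+ k) ≡ p
      eqn {k} k≤h = begin
        (suc h ∸ k) ℕ.+ (suc h ∸ k) ∸ 1 ℕ.+ (k ℕ.+ k)   ≡⟨ cong (ℕ._+ (k ℕ.+ k)) (reduce k≤h) ⟩
        suc ((h ∸ k) ℕ.+ (h ∸ k) ℕ.+ (k ℕ.+ k))         ≡⟨ cong suc (ℕSolver.solve 2 (λ d k → d ℕSolver.:+ d ℕSolver.:+ (k ℕSolver.:+ k) ℕSolver.:= (d ℕSolver.:+ k) ℕSolver.:+ (d ℕSolver.:+ k)) refl (h ∸ k) k) ⟩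
        suc (((h ∸ k) ℕ.+ k) ℕ.+ ((h ∸ k) ℕ.+ k))       ≡⟨ cong (λ d → suc (d ℕ.+ d)) (ℕₚ.m∸n+n≡m k≤h) ⟩
        suc (h ℕ.+ h)                                   ≡⟨ p≡2h+1 ⟨
        p                                               ∎

    Σ≡4E : Σ ≡ 2ℚ * 2ℚ * E
    Σ≡4E = trans (sum1to-cong h λ k 0<k _ → recip-double k {{ℕ.>-nonZero 0<k}}) (sum1to-*ˡ (2ℚ * 2ℚ) h λ k → recip² (k ℕ.+ k))

    -- Since Σ = 4 E, the combination 4 (O - E) - (U - Σ) equals 4 (E + O) - (Σ + U), and both E + O
    -- and Σ + U are H.
    3H-divisible : 1 ∣ᵖ H * (1ℚ + 2ℚ)
    3H-divisible = subst (1 ∣ᵖ_)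
      (begin
        (O - E) * (2ℚ * 2ℚ) - (U - Σ)
          ≡⟨ cong (λ σ → (O - E) * (2ℚ * 2ℚ) - (U - σ)) Σ≡4E ⟩
        (O - E) * (2ℚ * 2ℚ) - (U - 2ℚ * 2ℚ * E)
          ≡⟨ solve 3 (λ O E U → (O :- E) :* (con 2ℚ :* con 2ℚ) :- (U :- con 2ℚ :* con 2ℚ :* E)
               := (E :+ O) :* (con 2ℚ :* con 2ℚ) :- (con 2ℚ :* con 2ℚ :* E :+ U)) refl O E U ⟩
        (E + O) * (2ℚ * 2ℚ) - (2ℚ * 2ℚ * E + U)
          ≡⟨ cong (λ σ → (E + O) * (2ℚ * 2ℚ) - (σ + U)) Σ≡4E ⟨
        (E + O) * (2ℚ * 2ℚ) - (Σ + U)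
          ≡⟨ cong₂ (λ a b → a * (2ℚ * 2ℚ) - b) (sum1to-parity h recip²) (sum1to-+ h h recip²) ⟨
        H * (2ℚ * 2ℚ) - H
          ≡⟨ solve 1 (λ H → H :* (con 2ℚ :* con 2ℚ) :- H := H :* (con 1ℚ :+ con 2ℚ)) refl H ⟩
        H * (1ℚ + 2ℚ) ∎)
      (∣ᵖ-- (∣ᵖ-*ʳ O≡E (*-integral (ℕ→ℚ-integral 2) (ℕ→ℚ-integral 2))) U≡Σ)

    eq : ∀ H → H * (1ℚ + 2ℚ) * recip 3 ≡ H
    eq = solve 1 (λ H → H :* (con 1ℚ :+ con 2ℚ) :* con (recip 3) := H) refl

  ∣ᵖ-resp : ∀ {s u v} → u ≡ v → s ∣ᵖ u → s ∣ᵖ v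
  ∣ᵖ-resp {s} = subst (s ∣ᵖ_)

  -- Expansions at points divisible by p

  G-integral : ∀ {x} n → n < p → Integral x → Integral (G x n)
  G-integral n n<p i = *-integral
    (*-integral (poch-integral n (+-integral 1-integral i)) (poch-integral n (-‿integral 1-integral i)))
    (*-integral (recip!-integral n n<p) (recip!-integral n n<p))

  module _ {x} (p∣x : 1 ∣ᵖ x) where

    private
      x-integral : Integral x
      x-integral = ∣ᵖ⇒integral p∣x

      pred< : ∀ {n} → suc n < p → n < p
      pred< = ℕₚ.<-trans (ℕₚ.n<1+n _)

    G≡1 : ∀ n → n < p → 2 ∣ᵖ G x n - 1ℚ
    G≡1 zero _ = divides 0ℚ (ι-integral ℤ.0ℤ) (sym (ℚₚ.*-zeroʳ (π^ 2)))
    G≡1 (suc n) n<p = ∣ᵖ-resp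
      (trans (solve 3 (λ x g f → (g :- con 1ℚ) :- x :* x :* (f :* g) := g :* (con 1ℚ :- x :* x :* f) :- con 1ℚ)
               refl x (G x n) (recip² (suc n)))
             (cong (_- 1ℚ) (sym (G-suc x n))))
      (∣ᵖ-- (G≡1 n (pred< n<p))
            (∣ᵖ-*ʳ (∣ᵖ-* p∣x p∣x) (*-integral (recip²-integral z<s n<p) (G-integral n (pred< n<p) x-integral))))

    -- Expanding the product to first order in x², the only error of each new factor is x² (G - 1) /
    -- k². It is divisible even by p⁴, and one power is dropped.
    G≡1-x²H² : ∀ n → n < p → 3 ∣ᵖ (G x n - 1ℚ) + x * x * H² n
    G≡1-x²H² zero _ = divides 0ℚ (ι-integral ℤ.0ℤ) (trans
      (solve 1 (λ x → (con 1ℚ :- con 1ℚ) :+ x :* x :* con 0ℚ := con 0ℚ) refl x) (sym (ℚₚ.*-zeroʳ (π^ 3))))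
    G≡1-x²H² (suc n) n<p = ∣ᵖ-resp
      (trans (solve 4 (λ x g f H → ((g :- con 1ℚ) :+ x :* x :* H) :- x :* x :* (g :- con 1ℚ) :* f
                 := (g :* (con 1ℚ :- x :* x :* f) :- con 1ℚ) :+ x :* x :* (H :+ f))
               refl x (G x n) (recip² (suc n)) (H² n))
             (cong (λ g → (g - 1ℚ) + x * x * H² (suc n)) (sym (G-suc x n))))
      (∣ᵖ-- (G≡1-x²H² n (pred< n<p))
            (∣ᵖ-pred (∣ᵖ-*ʳ (∣ᵖ-* (∣ᵖ-* p∣x p∣x) (G≡1 n (pred< n<p))) (recip²-integral z<s n<p))))

    -- Each summand is x (1 - x/k) G / k². Replacing it by x/k² leaves x (G - 1) / k² and x² G / k³,
    -- both divisible by p².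
    F≡xH² : ∀ n → n < p → 2 ∣ᵖ F x n - x * H² n
    F≡xH² zero _ = divides 0ℚ (ι-integral ℤ.0ℤ) (trans
      (solve 1 (λ x → con 0ℚ :- x :* con 0ℚ := con 0ℚ) refl x) (sym (ℚₚ.*-zeroʳ (π^ 2))))
    F≡xH² (suc n) n<p = ∣ᵖ-resp eq
      (∣ᵖ-+ (F≡xH² n (pred< n<p))
            (∣ᵖ-- (∣ᵖ-* p∣x (∣ᵖ-pred (∣ᵖ-*ˡ (recip²-integral z<s n<p) (G≡1 n (pred< n<p)))))
                  (∣ᵖ-*ʳ (∣ᵖ-* p∣x p∣x) (*-integral (*-integral (recip²-integral z<s n<p) (recip<-integral n<p)) (G-integral n (pred< n<p) x-integral)))))
      where
      K = ℕ→ℚ (suc n)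
      i = recip (suc n)
      g = G x n
      eq : (F x n - x * H² n) + (x * (i * i * (g - 1ℚ)) - x * x * (i * i * i * g)) ≡ F x (suc n) - x * H² (suc n)
      eq = begin
        (F x n - x * H² n) + (x * (i * i * (g - 1ℚ)) - x * x * (i * i * i * g))
          ≡⟨ solve 5 (λ x i g f H → (f :- x :* H) :+ (x :* (i :* i :* (g :- con 1ℚ)) :- x :* x :* (i :* i :* i :* g))
               := (f :+ x :* (con 1ℚ :- x :* i) :* (i :* i) :* g) :- x :* (H :+ i :* i)) refl x i g (F x n) (H² n) ⟩
        (F x n + x * (1ℚ - x * i) * (i * i) * g) - x * (H² n + i * i)
          ≡⟨ cong (λ e → (F x n + x * (e - x * i) * (i * i) * g) - x * (H² n + i * i)) (*-recip (suc n)) ⟨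
        (F x n + x * (K * i - x * i) * (i * i) * g) - x * (H² n + i * i)
          ≡⟨ solve 6 (λ x i g f H K → (f :+ x :* (K :* i :- x :* i) :* (i :* i) :* g) :- x :* (H :+ i :* i)
               := (f :+ x :* (K :- x) :* (i :* i) :* g :* i) :- x :* (H :+ i :* i)) refl x i g (F x n) (H² n) K ⟩
        (F x n + x * (K - x) * (i * i) * g * i) - x * (H² n + i * i)
          ≡⟨ cong (λ t → (F x n + t * i) - x * (H² n + i * i)) (term-suc x n) ⟨
        F x (suc n) - x * H² (suc n) ∎

    S≡0 : ∀ n → n < p → 1 ∣ᵖ S x n
    S≡0 zero _ = divides 0ℚ (ι-integral ℤ.0ℤ) (sym (ℚₚ.*-zeroʳ (π^ 1)))
    S≡0 (suc n) n<p = ∣ᵖ-+ (S≡0 n (pred< n<p)) (∣ᵖ-*ʳ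
      (∣ᵖ-resp (sym (term-suc x n))
        (∣ᵖ-*ʳ (∣ᵖ-*ʳ (∣ᵖ-*ʳ p∣x (-‿integral (ℕ→ℚ-integral (suc n)) x-integral)) (recip²-integral z<s n<p))
               (G-integral n (pred< n<p) x-integral)))
      (recip²-integral z<s n<p))

  -- Ingredients of one step of the walk

  -- Each Pochhammer symbol in G contributes one multiple of p: the factor z + (j + 1) in the first
  -- and its mirror image p - (z + (j + 1)) in the second.
  G≡0 : ∀ {z n j} → p ≡ suc n → j < n → Integral z → 1 ∣ᵖ z + ℕ→ℚ (suc j) → 2 ∣ᵖ G z n
  G≡0 {z} {n} {j} refl j<n i p∣z+j = ∣ᵖ-*ʳ
    (∣ᵖ-* (∣ᵖ-poch n (+-integral 1-integral i) j<n (∣ᵖ-resp eq₁ p∣z+j))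
          (∣ᵖ-poch n (-‿integral 1-integral i) (ℕₚ.∸-monoʳ-< {n} {suc j} {0} z<s j<n) (∣ᵖ-resp eq₂ (∣ᵖ-- 1∣ᵖπ p∣z+j))))
    (*-integral (recip!-integral n ℕₚ.≤-refl) (recip!-integral n ℕₚ.≤-refl))
    where
    eq₁ : z + ℕ→ℚ (suc j) ≡ 1ℚ + z + ℕ→ℚ j
    eq₁ = trans (cong (λ J → z + J) (ℕ→ℚ-suc j))
      (solve 2 (λ z j → z :+ (con 1ℚ :+ j) := con 1ℚ :+ z :+ j) refl z (ℕ→ℚ j))
    eq₂ : π - (z + ℕ→ℚ (suc j)) ≡ 1ℚ - z + ℕ→ℚ (n ∸ suc j)
    eq₂ = begin
      π - (z + J)                              ≡⟨ cong (_- (z + J)) (ℕ→ℚ-suc n) ⟩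
      1ℚ + ℕ→ℚ n - (z + J)                     ≡⟨ cong (λ m → 1ℚ + ℕ→ℚ m - (z + J)) (ℕₚ.m∸n+n≡m j<n) ⟨
      1ℚ + ℕ→ℚ (n ∸ suc j ℕ.+ suc j) - (z + J) ≡⟨ cong (λ m → 1ℚ + m - (z + J)) (ℕ→ℚ-homo-+ (n ∸ suc j) (suc j)) ⟩
      1ℚ + (D + J) - (z + J)                   ≡⟨ solve 3 (λ z D J → con 1ℚ :+ (D :+ J) :- (z :+ J) := con 1ℚ :- z :+ D) refl z D J ⟩
      1ℚ - z + D                               ∎
      where
      J = ℕ→ℚ (suc j)
      D = ℕ→ℚ (n ∸ suc j)

  unit-π- : ∀ {t j} → Integral t → ¬ p ℕD.∣ j → ∃[ v ] Integral v × (π * t - ℕ→ℚ j) * v ≡ 1ℚ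
  unit-π- {t} {j} i p∤j = - v , neg-integral (proj₁ (proj₂ unit)) , trans
    (solve 4 (λ p t j v → (p :* t :- j) :* :- v := (j :+ p :* :- t) :* v) refl π t (ℕ→ℚ j) v) (proj₂ (proj₂ unit))
    where
    unit = p∤⇒unit p∤j (neg-integral i)
    v = proj₁ unit

  2-integral : Integral 2ℚ
  2-integral = ℕ→ℚ-integral 2

  -- The hypothesis says 1 - u′ = (1 - u) (1 - w) / (1 + w), and
  -- log ((1 + w) / (1 - w)) = 2 w + O(w³); the error here is exactly
  -- - 2 w (u + w)² / (1 + w)².
  log-step : ∀ {u u′ w v} → 1 ∣ᵖ u → 1 ∣ᵖ w → Integral v → (1ℚ + w) * v ≡ 1ℚ →
    u′ * (1ℚ + w) ≡ u + 2ℚ * w - u * w →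
    1 ∣ᵖ u′ × 3 ∣ᵖ (u′ + ½ * (u′ * u′)) - ((u + ½ * (u * u)) + 2ℚ * w)
  log-step {u} {u′} {w} {v} p∣u p∣w v-integral ev≡1 u′e≡N = p∣u′ , ∣ᵖ-resp eq
    (∣ᵖ-*ʳ (∣ᵖ-neg (∣ᵖ-*ˡ 2-integral (∣ᵖ-* p∣w (∣ᵖ-* (∣ᵖ-+ p∣u p∣w) (∣ᵖ-+ p∣u p∣w))))) (*-integral v-integral v-integral))
    where
    e = 1ℚ + w
    N = u + 2ℚ * w - u * w
    u′≡Nv : u′ ≡ N * v
    u′≡Nv = begin
      u′           ≡⟨ ℚₚ.*-identityʳ u′ ⟨
      u′ * 1ℚ      ≡⟨ cong (u′ *_) ev≡1 ⟨
      u′ * (e * v) ≡⟨ ℚₚ.*-assoc u′ e v ⟨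
      u′ * e * v   ≡⟨ cong (_* v) u′e≡N ⟩
      N * v        ∎
    p∣u′ : 1 ∣ᵖ u′
    p∣u′ = ∣ᵖ-resp (sym u′≡Nv) (∣ᵖ-*ʳ (∣ᵖ-- (∣ᵖ-+ p∣u (∣ᵖ-*ˡ 2-integral p∣w)) (∣ᵖ-*ʳ p∣u (∣ᵖ⇒integral p∣w))) v-integral)
    eq : - (2ℚ * (w * ((u + w) * (u + w)))) * (v * v) ≡ (u′ + ½ * (u′ * u′)) - ((u + ½ * (u * u)) + 2ℚ * w)
    -- Inserting powers of `e * v`, which is 1, makes the claim a polynomial identity in u, w and v,
    -- which the solver can check without knowing that v inverts e.
    eq = begin
      - (2ℚ * (w * ((u + w) * (u + w)))) * (v * v)
        ≡⟨ solve 3 (λ u w v → let N = u :+ con 2ℚ :* w :- u :* w; e = con 1ℚ :+ w in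
             :- (con 2ℚ :* (w :* ((u :+ w) :* (u :+ w)))) :* (v :* v)
               := (N :* v :* (e :* v) :+ con ½ :* ((N :* v) :* (N :* v))) :- ((u :+ con ½ :* (u :* u)) :+ con 2ℚ :* w) :* ((e :* v) :* (e :* v)))
             refl u w v ⟩
      (N * v * (e * v) + ½ * ((N * v) * (N * v))) - ((u + ½ * (u * u)) + 2ℚ * w) * ((e * v) * (e * v))
        ≡⟨ cong₂ (λ a b → (a * b + ½ * (a * a)) - ((u + ½ * (u * u)) + 2ℚ * w) * (b * b)) (sym u′≡Nv) ev≡1 ⟩
      (u′ * 1ℚ + ½ * (u′ * u′)) - ((u + ½ * (u * u)) + 2ℚ * w) * (1ℚ * 1ℚ)
        ≡⟨ cong₂ (λ a b → (a + ½ * (u′ * u′)) - b) (ℚₚ.*-identityʳ u′) (ℚₚ.*-identityʳ ((u + ½ * (u * u)) + 2ℚ * w)) ⟩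
      (u′ + ½ * (u′ * u′)) - ((u + ½ * (u * u)) + 2ℚ * w) ∎

  -- The walk from p y to x

  module _ (3<p : 3 < p) {n : ℕ} (p≡1+n : p ≡ suc n) where

    private
      n<p : n < p
      n<p = subst (n <_) (sym p≡1+n) (ℕₚ.n<1+n n)

      ½-integral : Integral ½
      ½-integral = recip-integral {2} (<⇒p∤ z<s (ℕₚ.<-trans (ℕₚ.n<1+n 2) 3<p))

    -- `u` is p Q at the point `x`, with the constant `κ` fixed for the whole walk. The logarithmic
    -- congruence concerns p F and u rather than F and Q, so division by p is postponed to
    -- `congruences`.
    record Invariant (κ x : ℚ) : Set where
      u : ℚ
      u = 1ℚ - W x p * κ
      field
        p∣u : 1 ∣ᵖ u
        F-integral : Integral (F x n)
        πF≡-log[1-u] : 3 ∣ᵖ π * F x n - (u + ½ * (u * u))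
        S≡-½F² : 1 ∣ᵖ S x n + ½ * (F x n * F x n)

    -- Every quantity vanishes to the required order: u = 1 - G ≡ x² H² ≡ 0 modulo p³, F ≡ x H² ≡ 0
    -- modulo p², and S ≡ 0 modulo p.
    invariant-base : ∀ {κ x} → 1 ∣ᵖ H² n → 1 ∣ᵖ x → W x p * κ ≡ G x n → Invariant κ x
    invariant-base {κ} {x} p∣H² p∣x Wκ≡G = record
      { p∣u = ∣ᵖ-pred (∣ᵖ-pred p³∣u)
      ; F-integral = ∣ᵖ⇒integral p²∣F
      ; πF≡-log[1-u] = ∣ᵖ-- (∣ᵖ-* 1∣ᵖπ p²∣F) (∣ᵖ-+ p³∣u (∣ᵖ-*ˡ ½-integral (∣ᵖ-*ʳ p³∣u (∣ᵖ⇒integral p³∣u))))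
      ; S≡-½F² = ∣ᵖ-+ (S≡0 p∣x n n<p) (∣ᵖ-pred (∣ᵖ-*ˡ ½-integral (∣ᵖ-*ʳ p²∣F (∣ᵖ⇒integral p²∣F))))
      }
      where
      p³∣u : 3 ∣ᵖ 1ℚ - W x p * κ
      p³∣u = ∣ᵖ-resp (trans (solve 3 (λ x g H → x :* x :* H :- ((g :- con 1ℚ) :+ x :* x :* H) := con 1ℚ :- g) refl x (G x n) (H² n))
                            (cong (λ g → 1ℚ - g) (sym Wκ≡G)))
        (∣ᵖ-- (∣ᵖ-* (∣ᵖ-* p∣x p∣x) p∣H²) (G≡1-x²H² p∣x n n<p))
      p²∣F : 2 ∣ᵖ F x n
      p²∣F = ∣ᵖ-resp (solve 2 (λ f a → (f :- a) :+ a := f) refl (F x n) (x * H² n))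
        (∣ᵖ-+ (F≡xH² p∣x n n<p) (∣ᵖ-* p∣x p∣H²))

    invariant-step : ∀ {κ t j} → Integral t → j < n → let z = π * t - ℕ→ℚ (suc j) in
      Invariant κ (1ℚ + z) → Invariant κ z
    invariant-step {κ} {t} {j} t-integral j<n inv = record
      { p∣u = proj₁ u′-estimate
      ; F-integral = F′-integral
      ; πF≡-log[1-u] = ∣ᵖ-resp πF′-eq
          (∣ᵖ-- (∣ᵖ-- πF≡-log[1-u] (proj₂ u′-estimate)) (∣ᵖ-*ˡ 2-integral (∣ᵖ-* p∣w p²∣g)))
      ; S≡-½F² = ∣ᵖ-resp (sym S′-eq) (∣ᵖ-+ S≡-½F² (∣ᵖ-pred (∣ᵖ-*ʳ p²∣g
          (-‿integral (*-integral (*-integral 2-integral (*-integral i-integral i-integral)) (-‿integral 1-integral g-integral))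
                      (*-integral (*-integral 2-integral i-integral) F′-integral)))))
      }
      where
      open Invariant inv
      J = ℕ→ℚ (suc j)
      z = π * t - J
      p∤1+j : ¬ p ℕD.∣ suc j
      p∤1+j = <⇒p∤ z<s (ℕₚ.≤-<-trans j<n n<p)
      z-inverse = unit-π- t-integral p∤1+j
      i = proj₁ z-inverse
      i-integral : Integral i
      i-integral = proj₁ (proj₂ z-inverse)
      zi≡1 : z * i ≡ 1ℚ
      zi≡1 = proj₂ (proj₂ z-inverse)
      w = π * i
      p∣w : 1 ∣ᵖ w
      p∣w = ∣ᵖ-*ʳ 1∣ᵖπ i-integral
      z-integral : Integral z
      z-integral = -‿integral (*-integral (ℕ→ℚ-integral p) t-integral) (ℕ→ℚ-integral (suc j))

      g = G z n
      p²∣g : 2 ∣ᵖ g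
      p²∣g = G≡0 p≡1+n j<n z-integral
        (∣ᵖ-resp (solve 2 (λ a J → a := (a :- J) :+ J) refl (π * t) J) (∣ᵖ-*ʳ 1∣ᵖπ t-integral))
      g-integral : Integral g
      g-integral = ∣ᵖ⇒integral p²∣g

      F₁ = F (1ℚ + z) n
      F′ = F z n
      F₁-eq : F₁ ≡ F′ + i * (2ℚ * (g - 1ℚ))
      F₁-eq = begin
        F₁                                ≡⟨ solve 2 (λ a b → a := b :+ con 1ℚ :* (a :- b)) refl F₁ F′ ⟩
        F′ + 1ℚ * (F₁ - F′)               ≡⟨ cong (λ e → F′ + e * (F₁ - F′)) zi≡1 ⟨
        F′ + z * i * (F₁ - F′)            ≡⟨ solve 4 (λ z i a b → b :+ z :* i :* (a :- b) := b :+ i :* (z :* (a :- b))) refl z i F₁ F′ ⟩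
        F′ + i * (z * (F₁ - F′))          ≡⟨ cong (λ d → F′ + i * d) (F-shift z n) ⟩
        F′ + i * (2ℚ * (g - 1ℚ))          ∎
      F′-integral : Integral F′
      F′-integral = subst Integral
        (trans (cong (_- i * (2ℚ * (g - 1ℚ))) F₁-eq) (solve 2 (λ f d → f :+ d :- d := f) refl F′ (i * (2ℚ * (g - 1ℚ)))))
        (-‿integral F-integral (*-integral i-integral (*-integral 2-integral (-‿integral g-integral 1-integral))))

      S₁ = S (1ℚ + z) n
      S′ = S z n
      -- If g were 0, the shifts would read F₁ = F′ - 2/z and S₁ = S′ + 2 F′/z - 2/z², and these
      -- leave S + F²/2 exactly unchanged. What remains is therefore a multiple of g.
      S′-eq : S′ + ½ * (F′ * F′) ≡ (S₁ + ½ * (F₁ * F₁)) + g * (2ℚ * (i * i) * (1ℚ - g) - 2ℚ * i * F′)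
      S′-eq = begin
        S′ + ½ * (F′ * F′)
          ≡⟨ solve 3 (λ a b f → b :+ con ½ :* (f :* f) := a :- con 1ℚ :* con 1ℚ :* (a :- b) :+ con ½ :* (f :* f)) refl S₁ S′ F′ ⟩
        S₁ - 1ℚ * 1ℚ * (S₁ - S′) + ½ * (F′ * F′)
          ≡⟨ cong (λ e → S₁ - e * e * (S₁ - S′) + ½ * (F′ * F′)) zi≡1 ⟨
        S₁ - z * i * (z * i) * (S₁ - S′) + ½ * (F′ * F′)
          ≡⟨ solve 5 (λ z i a b f → a :- z :* i :* (z :* i) :* (a :- b) :+ con ½ :* (f :* f)
               := a :- i :* i :* (z :* z :* (a :- b)) :+ con ½ :* (f :* f)) refl z i S₁ S′ F′ ⟩
        S₁ - i * i * (z * z * (S₁ - S′)) + ½ * (F′ * F′)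
          ≡⟨ cong (λ d → S₁ - i * i * d + ½ * (F′ * F′)) (S-shift z n) ⟩
        S₁ - i * i * (2ℚ * (z * F′ - (1ℚ - g))) + ½ * (F′ * F′)
          ≡⟨ solve 5 (λ z i a f g → a :- i :* i :* (con 2ℚ :* (z :* f :- (con 1ℚ :- g))) :+ con ½ :* (f :* f)
               := a :- con 2ℚ :* i :* (z :* i :* f :- i :* (con 1ℚ :- g)) :+ con ½ :* (f :* f)) refl z i S₁ F′ g ⟩
        S₁ - 2ℚ * i * (z * i * F′ - i * (1ℚ - g)) + ½ * (F′ * F′)
          ≡⟨ cong (λ e → S₁ - 2ℚ * i * (e * F′ - i * (1ℚ - g)) + ½ * (F′ * F′)) zi≡1 ⟩
        S₁ - 2ℚ * i * (1ℚ * F′ - i * (1ℚ - g)) + ½ * (F′ * F′)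
          ≡⟨ solve 4 (λ i a f g → let f₁ = f :+ i :* (con 2ℚ :* (g :- con 1ℚ)) in
               a :- con 2ℚ :* i :* (con 1ℚ :* f :- i :* (con 1ℚ :- g)) :+ con ½ :* (f :* f)
               := (a :+ con ½ :* (f₁ :* f₁)) :+ g :* (con 2ℚ :* (i :* i) :* (con 1ℚ :- g) :- con 2ℚ :* i :* f)) refl i S₁ F′ g ⟩
        (S₁ + ½ * ((F′ + i * (2ℚ * (g - 1ℚ))) * (F′ + i * (2ℚ * (g - 1ℚ))))) + g * (2ℚ * (i * i) * (1ℚ - g) - 2ℚ * i * F′)
          ≡⟨ cong (λ f → (S₁ + ½ * (f * f)) + g * (2ℚ * (i * i) * (1ℚ - g) - 2ℚ * i * F′)) F₁-eq ⟨
        (S₁ + ½ * (F₁ * F₁)) + g * (2ℚ * (i * i) * (1ℚ - g) - 2ℚ * i * F′) ∎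

      W₁ = W (1ℚ + z) p
      W′ = W z p
      -- This is `W-shift` with n = p, divided by -z² by means of the inverse i of z.
      W-eq : W′ * κ * (1ℚ + w) ≡ W₁ * κ * (1ℚ - w)
      W-eq = begin
        W′ * κ * (1ℚ + π * i)
          ≡⟨ cong (λ e → W′ * κ * (e + π * i)) (sym zi≡1) ⟩
        W′ * κ * (z * i + π * i)
          ≡⟨ solve 5 (λ z i W κ π → W :* κ :* (z :* i :+ π :* i) := con 1ℚ :* (κ :* i :* (W :* (z :+ π)))) refl z i W′ κ π ⟩
        1ℚ * (κ * i * (W′ * (z + π)))
          ≡⟨ cong (_* (κ * i * (W′ * (z + π)))) (sym zi≡1) ⟩
        z * i * (κ * i * (W′ * (z + π)))
          ≡⟨ solve 5 (λ z i W κ π → z :* i :* (κ :* i :* (W :* (z :+ π))) := :- (κ :* i :* i :* (W :* (z :+ π) :* :- z))) refl z i W′ κ π ⟩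
        - (κ * i * i * (W′ * (z + π) * - z))
          ≡⟨ cong (λ d → - (κ * i * i * d)) (W-shift z p) ⟨
        - (κ * i * i * (W₁ * (z * (π - z))))
          ≡⟨ solve 5 (λ z i W κ π → :- (κ :* i :* i :* (W :* (z :* (π :- z)))) := z :* i :* (κ :* W :* (z :* i :- π :* i))) refl z i W₁ κ π ⟩
        z * i * (κ * W₁ * (z * i - π * i))
          ≡⟨ cong (λ e → e * (κ * W₁ * (e - π * i))) zi≡1 ⟩
        1ℚ * (κ * W₁ * (1ℚ - π * i))
          ≡⟨ solve 3 (λ W κ w → con 1ℚ :* (κ :* W :* (con 1ℚ :- w)) := W :* κ :* (con 1ℚ :- w)) refl W₁ κ (π * i) ⟩
        W₁ * κ * (1ℚ - π * i) ∎

      u′-estimate : let u′ = 1ℚ - W′ * κ in 1 ∣ᵖ u′ × 3 ∣ᵖ (u′ + ½ * (u′ * u′)) - ((u + ½ * (u * u)) + 2ℚ * w)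
      u′-estimate = log-step p∣u p∣w (*-integral z-integral v-integral) ev≡1 (begin
        (1ℚ - W′ * κ) * (1ℚ + w)
          ≡⟨ solve 2 (λ A w → (con 1ℚ :- A) :* (con 1ℚ :+ w) := con 1ℚ :+ w :- A :* (con 1ℚ :+ w)) refl (W′ * κ) w ⟩
        1ℚ + w - W′ * κ * (1ℚ + w)
          ≡⟨ cong (λ d → 1ℚ + w - d) W-eq ⟩
        1ℚ + w - W₁ * κ * (1ℚ - w)
          ≡⟨ solve 2 (λ A w → con 1ℚ :+ w :- A :* (con 1ℚ :- w) := (con 1ℚ :- A) :+ con 2ℚ :* w :- (con 1ℚ :- A) :* w) refl (W₁ * κ) w ⟩
        u + 2ℚ * w - u * w ∎)
        where
        -- Since 1 + w = (z + p) / z, its inverse is z / (z + p); and z + p = p (1 + t) - J is a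
        -- unit for the same reason as z.
        z+π-inverse = unit-π- (+-integral 1-integral t-integral) p∤1+j
        v = proj₁ z+π-inverse
        v-integral : Integral v
        v-integral = proj₁ (proj₂ z+π-inverse)
        v-eq : (π * (1ℚ + t) - J) * v ≡ 1ℚ
        v-eq = proj₂ (proj₂ z+π-inverse)
        ev≡1 : (1ℚ + w) * (z * v) ≡ 1ℚ
        ev≡1 = begin
          (1ℚ + π * i) * (z * v)              ≡⟨ solve 4 (λ z i π v → (con 1ℚ :+ π :* i) :* (z :* v) := (z :+ π :* (z :* i)) :* v) refl z i π v ⟩
          (z + π * (z * i)) * v               ≡⟨ cong (λ e → (z + π * e) * v) zi≡1 ⟩
          (z + π * 1ℚ) * v                    ≡⟨ solve 4 (λ π t J v → (π :* t :- J :+ π :* con 1ℚ) :* v := (π :* (con 1ℚ :+ t) :- J) :* v) refl π t J v ⟩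
          (π * (1ℚ + t) - J) * v              ≡⟨ v-eq ⟩
          1ℚ                                  ∎

      πF′-eq : let u′ = 1ℚ - W′ * κ in
        ((π * F₁ - (u + ½ * (u * u))) - ((u′ + ½ * (u′ * u′)) - ((u + ½ * (u * u)) + 2ℚ * w))) - 2ℚ * (w * g)
          ≡ π * F′ - (u′ + ½ * (u′ * u′))
      πF′-eq = trans
        (cong (λ f → ((π * f - (u + ½ * (u * u))) - ((u′ + ½ * (u′ * u′)) - ((u + ½ * (u * u)) + 2ℚ * w))) - 2ℚ * (w * g)) F₁-eq)
        (solve 6 (λ π i f g a b → ((π :* (f :+ i :* (con 2ℚ :* (g :- con 1ℚ))) :- a) :- (b :- (a :+ con 2ℚ :* (π :* i)))) :- con 2ℚ :* (π :* i :* g)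
          := π :* f :- b) refl π i F′ g (u + ½ * (u * u)) (u′ + ½ * (u′ * u′)))
        where u′ = 1ℚ - W′ * κ

    invariant : ∀ {κ t} a → a ≤ n → Integral t → Invariant κ (π * t) → Invariant κ (π * t - ℕ→ℚ a)
    invariant {κ} {t} zero _ _ inv = subst (Invariant κ) (solve 1 (λ x → x := x :- con 0ℚ) refl (π * t)) inv
    invariant {κ} {t} (suc a) a<n i inv = invariant-step i a<n (subst (Invariant κ)
      (trans (solve 2 (λ x a → x :- a := con 1ℚ :+ (x :- (con 1ℚ :+ a))) refl (π * t) (ℕ→ℚ a))
             (cong (λ a → 1ℚ + (π * t - a)) (sym (ℕ→ℚ-suc a))))
      (invariant a (ℕₚ.<⇒≤ a<n) i inv))

    -- c stands for m² / ([r/p]ₘ [-r/p]ₘ).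
    W-base : ∀ {y c} → y * (1ℚ - y) * c ≡ 1ℚ → W (π * y) p * (recip! p * recip! p * c) ≡ G (π * y) n
    W-base {y} {c} yc≡1 = begin
      W (π * y) p * (recip! p * recip! p * c)
        ≡⟨ cong (λ m → W (π * y) m * (recip! m * recip! m * c)) p≡1+n ⟩
      poch x (suc n) * (P′ * (1ℚ - x + ℕ→ℚ n)) * (f * recip (suc n) * (f * recip (suc n)) * c)
        ≡⟨ cong₂ (λ P i → P * (P′ * (1ℚ - x + ℕ→ℚ n)) * (f * i * (f * i) * c)) (poch-suc x n) (cong recip (sym p≡1+n)) ⟩
      x * P * (P′ * (1ℚ - x + ℕ→ℚ n)) * (f * i * (f * i) * c)
        ≡⟨ solve 7 (λ x P P′ n f i c → x :* P :* (P′ :* (con 1ℚ :- x :+ n)) :* (f :* i :* (f :* i) :* c)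
             := P :* P′ :* (f :* f) :* (x :* ((con 1ℚ :+ n) :- x) :* (i :* i) :* c)) refl x P P′ (ℕ→ℚ n) f i c ⟩
      G x n * (x * ((1ℚ + ℕ→ℚ n) - x) * (i * i) * c)
        ≡⟨ cong (λ q → G x n * (x * (q - x) * (i * i) * c)) (trans (sym (ℕ→ℚ-suc n)) (cong ℕ→ℚ (sym p≡1+n))) ⟩
      G x n * (π * y * (π - π * y) * (i * i) * c)
        -- Here x (p - x) = p² y (1 - y): the p² meets the two factors 1/p left over from p!², and c
        -- inverts the rest.
        ≡⟨ cong (G x n *_) (solve 4 (λ π y i c → π :* y :* (π :- π :* y) :* (i :* i) :* c
             := π :* i :* (π :* i) :* (y :* (con 1ℚ :- y) :* c)) refl π y i c) ⟩
      G x n * (π * i * (π * i) * (y * (1ℚ - y) * c))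
        ≡⟨ cong₂ (λ a b → G x n * (a * a * b)) π*recip-p yc≡1 ⟩
      G x n * 1ℚ
        ≡⟨ ℚₚ.*-identityʳ (G x n) ⟩
      G x n ∎
      where
      x = π * y
      P = poch (1ℚ + x) n
      P′ = poch (1ℚ - x) n
      f = recip! n
      i = recip p

    -- With u = p Q, the truncated logarithm u + u²/2 is p (Q + p Q²/2), so p cancels. The second
    -- congruence then exchanges F² for Q², because F² - Q² has the factor F - Q, which is divisible
    -- by p.
    congruences : ∀ {κ x} → Invariant κ x → let Q = recip p * (1ℚ - W x p * κ) in
      2 ∣ᵖ F x n - (Q + ½ * π * (Q * Q)) × 1 ∣ᵖ S x n - - (½ * (Q * Q))
    congruences {κ} {x} inv = F≡ , ∣ᵖ-resp
      (solve 3 (λ s f q → (s :+ con ½ :* (f :* f)) :- (con ½ :* ((f :- q) :* (f :+ q))) := s :- :- (con ½ :* (q :* q))) refl (S x n) (F x n) Q)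
      (∣ᵖ-- S≡-½F² (∣ᵖ-*ˡ ½-integral (∣ᵖ-*ʳ F≡Q (+-integral F-integral Q-integral))))
      where
      open Invariant inv
      Q = recip p * u
      u≡πQ : u ≡ π * Q
      u≡πQ = begin
        u                ≡⟨ ℚₚ.*-identityˡ u ⟨
        1ℚ * u           ≡⟨ cong (_* u) π*recip-p ⟨
        π * recip p * u  ≡⟨ ℚₚ.*-assoc π (recip p) u ⟩
        π * Q            ∎
      Q-integral : Integral Q
      Q-integral = ∣ᵖ⇒integral (∣ᵖ-cancel-π (∣ᵖ-resp u≡πQ p∣u))
      F≡ : 2 ∣ᵖ F x n - (Q + ½ * π * (Q * Q))
      F≡ = ∣ᵖ-cancel-π (∣ᵖ-resp
        (trans (cong (λ u → π * F x n - (u + ½ * (u * u))) u≡πQ)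
          (solve 3 (λ π f q → π :* f :- (π :* q :+ con ½ :* ((π :* q) :* (π :* q))) := π :* (f :- (q :+ con ½ :* π :* (q :* q)))) refl π (F x n) Q))
        πF≡-log[1-u])
      F≡Q : 1 ∣ᵖ F x n - Q
      F≡Q = ∣ᵖ-resp (solve 3 (λ π f q → (f :- (q :+ con ½ :* π :* (q :* q))) :+ π :* (con ½ :* (q :* q)) := f :- q) refl π (F x n) Q)
        (∣ᵖ-+ (∣ᵖ-pred F≡) (∣ᵖ-*ʳ 1∣ᵖπ (*-integral ½-integral (*-integral Q-integral Q-integral))))

-- Specialisation to x = r/m

module _ {p r m a s : ℕ} (p-prime : Prime p) (3<p : 3 < p) (0<r : 0 < r) (r<m : r < m) (m⊥p : Coprime m p)
  (a<p : a < p) (sp≡r+am : s ℕ.* p ≡ r ℕ.+ a ℕ.* m) where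

  private
    instance
      p≢0 : ℕ.NonZero p
      p≢0 = prime⇒nonZero p-prime
      m≢0 : ℕ.NonZero m
      m≢0 = ℕ.>-nonZero (ℕₚ.<-trans 0<r r<m)

    n = p ∸ 1
    p≡1+n : p ≡ suc n
    p≡1+n = sym (ℕₚ.m+[n∸m]≡n (ℕₚ.<-trans z<s 3<p))

    0<s : 0 < s
    0<s = ℕₚ.*-cancelʳ-< p 0 s (subst (0 <_) (sym sp≡r+am) (ℕₚ.<-≤-trans 0<r (ℕₚ.m≤m+n r (a ℕ.* m))))

    -- s p = r + a m < (1 + a) m ≤ p m.
    s<m : s < m
    s<m = ℕₚ.*-cancelʳ-< p s m (ℕₚ.<-≤-trans
      (subst (_< m ℕ.+ a ℕ.* m) (sym sp≡r+am) (ℕₚ.+-monoˡ-< (a ℕ.* m) r<m))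
      (ℕₚ.≤-trans (ℕₚ.*-monoˡ-≤ m a<p) (ℕₚ.≤-reflexive (ℕₚ.*-comm p m))))

    s′ = m ∸ s
    0<s′ : 0 < s′
    0<s′ = ℕₚ.m<n⇒0<n∸m s<m
    s+s′≡m : s ℕ.+ s′ ≡ m
    s+s′≡m = ℕₚ.m+[n∸m]≡n (ℕₚ.<⇒≤ s<m)
    s′<m : s′ < m
    s′<m = ℕₚ.∸-monoʳ-< {m} {s} {0} 0<s (ℕₚ.<⇒≤ s<m)

    r/p = ℕ→ℚ r ⊘ ℕ→ℚ p
    r/p*p : r/p * ℕ→ℚ p ≡ ℕ→ℚ r
    r/p*p = begin
      r/p * ℕ→ℚ p                    ≡⟨ cong (_* ℕ→ℚ p) (⊘≡* (ℕ→ℚ r) (ℕ→ℚ p) (recip p) (*-recip p)) ⟩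
      ℕ→ℚ r * recip p * ℕ→ℚ p        ≡⟨ solve 3 (λ r i p → r :* i :* p := r :* (p :* i)) refl (ℕ→ℚ r) (recip p) (ℕ→ℚ p) ⟩
      ℕ→ℚ r * (ℕ→ℚ p * recip p)      ≡⟨ cong (ℕ→ℚ r *_) (*-recip p) ⟩
      ℕ→ℚ r * 1ℚ                     ≡⟨ ℚₚ.*-identityʳ (ℕ→ℚ r) ⟩
      ℕ→ℚ r                          ∎

    [r/p]≡s : resMod m r/p ≡ s
    [r/p]≡s = resMod-unique m⊥p {e = + r} r/p*p s<m (ℕD.divides a (cong ∣_∣ (begin
      + s ℤ.* + p ℤ.- + r               ≡⟨ cong (ℤ._- + r) (ℤₚ.pos-* s p) ⟨
      + (s ℕ.* p) ℤ.- + r               ≡⟨ cong (λ k → + k ℤ.- + r) sp≡r+am ⟩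
      + r ℤ.+ + (a ℕ.* m) ℤ.- + r       ≡⟨ ℤSolver.solve 2 (λ r b → r ℤSolver.:+ b ℤSolver.:- r ℤSolver.:= b) refl (+ r) (+ (a ℕ.* m)) ⟩
      + (a ℕ.* m)                       ∎)))

    [-r/p]≡s′ : resMod m (- r/p) ≡ s′
    [-r/p]≡s′ = resMod-unique m⊥p {e = ℤ.- + r}
      (trans (sym (ℚₚ.neg-distribˡ-* r/p (ℕ→ℚ p))) (trans (cong -_ r/p*p) (sym (ι-homo-neg (+ r))))) s′<m
      (subst (λ k → m ℕD.∣ ∣ k ∣) (sym residual) (ℕD.∣m+n∣m⇒∣n (ℕD.divides p am+s′p+r) (ℕD.n∣m*n a)))
      where
      residual : + s′ ℤ.* + p ℤ.- ℤ.- + r ≡ + (s′ ℕ.* p ℕ.+ r)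
      residual = cong₂ ℤ._+_ (sym (ℤₚ.pos-* s′ p)) (ℤₚ.neg-involutive (+ r))
      am+s′p+r : a ℕ.* m ℕ.+ (s′ ℕ.* p ℕ.+ r) ≡ p ℕ.* m
      am+s′p+r = begin
        a ℕ.* m ℕ.+ (s′ ℕ.* p ℕ.+ r)     ≡⟨ ℕSolver.solve 3 (λ b c r → b ℕSolver.:+ (c ℕSolver.:+ r) ℕSolver.:= (r ℕSolver.:+ b) ℕSolver.:+ c) refl (a ℕ.* m) (s′ ℕ.* p) r ⟩
        (r ℕ.+ a ℕ.* m) ℕ.+ s′ ℕ.* p     ≡⟨ cong (ℕ._+ s′ ℕ.* p) sp≡r+am ⟨
        s ℕ.* p ℕ.+ s′ ℕ.* p             ≡⟨ ℕₚ.*-distribʳ-+ p s s′ ⟨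
        (s ℕ.+ s′) ℕ.* p                 ≡⟨ cong (ℕ._* p) s+s′≡m ⟩
        m ℕ.* p                          ≡⟨ ℕₚ.*-comm m p ⟩
        p ℕ.* m                          ∎

    x = ℕ→ℚ r ⊘ ℕ→ℚ m
    y = ℕ→ℚ s * recip m

    x≡py-a : ℕ→ℚ p * y - ℕ→ℚ a ≡ x
    x≡py-a = begin
      ℕ→ℚ p * (ℕ→ℚ s * recip m) - ℕ→ℚ a
        ≡⟨ solve 4 (λ p s i a → p :* (s :* i) :- a := s :* p :* i :- a :* con 1ℚ) refl (ℕ→ℚ p) (ℕ→ℚ s) (recip m) (ℕ→ℚ a) ⟩
      ℕ→ℚ s * ℕ→ℚ p * recip m - ℕ→ℚ a * 1ℚ
        ≡⟨ cong₂ (λ b e → b * recip m - ℕ→ℚ a * e) sp (sym (*-recip m)) ⟩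
      (ℕ→ℚ r + ℕ→ℚ a * ℕ→ℚ m) * recip m - ℕ→ℚ a * (ℕ→ℚ m * recip m)
        ≡⟨ solve 4 (λ r a m i → (r :+ a :* m) :* i :- a :* (m :* i) := r :* i) refl (ℕ→ℚ r) (ℕ→ℚ a) (ℕ→ℚ m) (recip m) ⟩
      ℕ→ℚ r * recip m
        ≡⟨ ⊘≡* (ℕ→ℚ r) (ℕ→ℚ m) (recip m) (*-recip m) ⟨
      x ∎
      where
      sp : ℕ→ℚ s * ℕ→ℚ p ≡ ℕ→ℚ r + ℕ→ℚ a * ℕ→ℚ m
      sp = trans (sym (ℕ→ℚ-homo-* s p)) (trans (cong ℕ→ℚ sp≡r+am)
        (trans (ℕ→ℚ-homo-+ r (a ℕ.* m)) (cong (λ b → ℕ→ℚ r + b) (ℕ→ℚ-homo-* a m))))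

    c = (ℕ→ℚ m * ℕ→ℚ m) ⊘ (ℕ→ℚ s * ℕ→ℚ s′)
    -- Since s + s′ = m, 1 - y is s′/m; thus y (1 - y) = s s′ / m², the reciprocal of the constant
    -- built from the two residues.
    y[1-y]c≡1 : y * (1ℚ - y) * c ≡ 1ℚ
    y[1-y]c≡1 = begin
      σ * i * (1ℚ - σ * i) * c
        ≡⟨ cong₂ (λ e c → σ * i * (e - σ * i) * c) (sym mi≡1) (⊘≡* (μ * μ) (σ * σ′) (recip s * recip s′) ss′-inverse) ⟩
      σ * i * (μ * i - σ * i) * (μ * μ * (recip s * recip s′))
        ≡⟨ cong (λ k → σ * i * (k * i - σ * i) * (μ * μ * (recip s * recip s′))) (trans (cong ℕ→ℚ (sym s+s′≡m)) (ℕ→ℚ-homo-+ s s′)) ⟩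
      σ * i * ((σ + σ′) * i - σ * i) * (μ * μ * (recip s * recip s′))
        ≡⟨ solve 6 (λ σ σ′ i μ j j′ → σ :* i :* ((σ :+ σ′) :* i :- σ :* i) :* (μ :* μ :* (j :* j′))
             := μ :* i :* (μ :* i) :* (σ :* σ′ :* (j :* j′))) refl σ σ′ i μ (recip s) (recip s′) ⟩
      μ * i * (μ * i) * (σ * σ′ * (recip s * recip s′))
        ≡⟨ cong₂ (λ e d → e * e * d) mi≡1 ss′-inverse ⟩
      1ℚ ∎
      where
      σ = ℕ→ℚ s
      σ′ = ℕ→ℚ s′
      μ = ℕ→ℚ m
      i = recip m
      mi≡1 : μ * i ≡ 1ℚ
      mi≡1 = *-recip m
      ss′-inverse : σ * σ′ * (recip s * recip s′) ≡ 1ℚ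
      ss′-inverse = trans (solve 4 (λ a b c d → a :* b :* (c :* d) := a :* c :* (b :* d)) refl σ σ′ (recip s) (recip s′))
        (cong₂ _*_ (*-recip s {{ℕ.>-nonZero 0<s}}) (*-recip s′ {{ℕ.>-nonZero 0<s′}}))

    t : ℕ → ℚ
    t k = W x k ⊘ (poch 1ℚ k * poch 1ℚ k)

    κ = recip! p * recip! p * c
    Q = recip p * (1ℚ - W x p * κ)

    1⊘poch² : ∀ k u → u ⊘ (poch 1ℚ k * poch 1ℚ k) ≡ u * (recip! k * recip! k)
    1⊘poch² k u = ⊘≡* u (poch 1ℚ k * poch 1ℚ k) (recip! k * recip! k) (trans
      (solve 2 (λ P f → P :* P :* (f :* f) := P :* f :* (P :* f)) refl (poch 1ℚ k) (recip! k))
      (cong₂ _*_ (poch-1 k) (poch-1 k)))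

    Qp≡Q : Qp p r m ≡ Q
    Qp≡Q = begin
      Qp p r m
        ≡⟨ cong₂ (λ a b → recip p * (1ℚ - W x p ⊘ (poch 1ℚ p * poch 1ℚ p) * ((ℕ→ℚ m * ℕ→ℚ m) ⊘ (ℕ→ℚ a * ℕ→ℚ b)))) [r/p]≡s [-r/p]≡s′ ⟩
      recip p * (1ℚ - W x p ⊘ (poch 1ℚ p * poch 1ℚ p) * c)
        ≡⟨ cong (λ d → recip p * (1ℚ - d * c)) (1⊘poch² p (W x p)) ⟩
      recip p * (1ℚ - W x p * (recip! p * recip! p) * c)
        ≡⟨ cong (λ d → recip p * (1ℚ - d)) (ℚₚ.*-assoc (W x p) (recip! p * recip! p) c) ⟩
      Q ∎

    sum-F : sum1to n (λ k → t k ⊘ ℕ→ℚ k) ≡ F x n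
    sum-F = sum1to-cong n λ k 0<k _ → trans (⊘≡* (t k) (ℕ→ℚ k) (recip k) (*-recip k {{ℕ.>-nonZero 0<k}})) (cong (_* recip k) (1⊘poch² k (W x k)))

    sum-S : sum1to n (λ k → t k ⊘ (ℕ→ℚ k * ℕ→ℚ k)) ≡ S x n
    sum-S = sum1to-cong n λ k 0<k _ → trans
      (⊘≡* (t k) (ℕ→ℚ k * ℕ→ℚ k) (recip k * recip k) (trans (solve 2 (λ K i → K :* K :* (i :* i) := K :* i :* (K :* i)) refl (ℕ→ℚ k) (recip k))
                  (cong₂ _*_ (*-recip k {{ℕ.>-nonZero 0<k}}) (*-recip k {{ℕ.>-nonZero 0<k}}))))
      (cong (_* (recip k * recip k)) (1⊘poch² k (W x k)))

    p∤m : ¬ p ℕD.∣ m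
    p∤m p∣m = p∤1 p p-prime (subst (p ℕD.∣_) (m⊥p (p∣m , ℕD.∣-refl)) ℕD.∣-refl)

    y-integral : Integral p p-prime y
    y-integral = *-integral p p-prime (ℕ→ℚ-integral p p-prime s) (recip-integral p p-prime p∤m)

    h = proj₁ (prime-odd p-prime (ℕₚ.<-trans (ℕₚ.n<1+n 2) 3<p))
    p≡1+2h : p ≡ suc (h ℕ.+ h)
    p≡1+2h = proj₂ (prime-odd p-prime (ℕₚ.<-trans (ℕₚ.n<1+n 2) 3<p))

    p∣H² : _∣ᵖ_ p p-prime 1 (H² p p-prime n)
    p∣H² = subst (λ k → _∣ᵖ_ p p-prime 1 (H² p p-prime k)) (ℕₚ.suc-injective (trans (sym p≡1+2h) p≡1+n))
      (H²-divisible p p-prime 3<p h p≡1+2h)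

    F,S-congruences = congruences p p-prime 3<p p≡1+n (subst (Invariant p p-prime 3<p p≡1+n κ) x≡py-a
      (invariant p p-prime 3<p p≡1+n a (ℕₚ.≤-pred (subst (a <_) p≡1+n a<p)) y-integral
        (invariant-base p p-prime 3<p p≡1+n p∣H² (∣ᵖ-*ʳ p p-prime (1∣ᵖπ p p-prime) y-integral)
          (W-base p p-prime 3<p p≡1+n y[1-y]c≡1))))

  sum-F≡ : sum1to (p ∸ 1) (λ k → t k ⊘ ℕ→ℚ k) ≡ Qp p r m + ½ * ℕ→ℚ p * (Qp p r m * Qp p r m) mod p ^ 2
  sum-F≡ = ∣ᵖ⇒≡mod p p-prime (sum1to (p ∸ 1) (λ k → t k ⊘ ℕ→ℚ k)) (Qp p r m + ½ * ℕ→ℚ p * (Qp p r m * Qp p r m)) (subst (_∣ᵖ_ p p-prime 2)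
    (cong₂ (λ s q → s - (q + ½ * ℕ→ℚ p * (q * q))) (sym sum-F) (sym Qp≡Q)) (proj₁ F,S-congruences))

  sum-S≡ : sum1to (p ∸ 1) (λ k → t k ⊘ (ℕ→ℚ k * ℕ→ℚ k)) ≡ - (½ * (Qp p r m * Qp p r m)) mod p ^ 1
  sum-S≡ = ∣ᵖ⇒≡mod p p-prime (sum1to (p ∸ 1) (λ k → t k ⊘ (ℕ→ℚ k * ℕ→ℚ k))) (- (½ * (Qp p r m * Qp p r m))) (subst (_∣ᵖ_ p p-prime 1)
    (cong₂ (λ s q → s - - (½ * (q * q))) (sym sum-S) (sym Qp≡Q)) (proj₂ F,S-congruences))

theorem3p1 : (p r m : ℕ) → Prime p → 3 < p → 0 < r → r < m → Coprime m p →
    let x = ℕ→ℚ r ⊘ ℕ→ℚ m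
        Q = Qp p r m
        t = λ k → (poch x k * poch (1ℚ - x) k) ⊘ (poch 1ℚ k * poch 1ℚ k)
    in (sum1to (p ∸ 1) (λ k → t k ⊘ ℕ→ℚ k)
          ≡ Q + (1ℚ ⊘ ℕ→ℚ 2) * ℕ→ℚ p * (Q * Q) mod p ^ 2)
     × (sum1to (p ∸ 1) (λ k → t k ⊘ (ℕ→ℚ k * ℕ→ℚ k))
          ≡ - ((1ℚ ⊘ ℕ→ℚ 2) * (Q * Q)) mod p ^ 1)
-- The `1ℚ ⊘ ℕ→ℚ 2` of the statement evaluates to `½`, so both results fit as they are.
theorem3p1 p r m p-prime 3<p 0<r r<m m⊥p =
    sum-F≡ {a = a} {s} p-prime 3<p 0<r r<m m⊥p a<p sp≡r+am , sum-S≡ {a = a} {s} p-prime 3<p 0<r r<m m⊥p a<p sp≡r+am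
  where
  lift = solve-congruence r {{prime⇒nonZero p-prime}} m⊥p
  a = proj₁ lift
  s = proj₁ (proj₂ (proj₂ lift))
  a<p = proj₁ (proj₂ lift)
  sp≡r+am = proj₂ (proj₂ (proj₂ lift))
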